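{- There is an absolute constant $c > 0$ such that for all integers $m \ge 1$ and $n \ge 1$, every symplectic operator $S \in \mathrm{Sp}_{2m}(\mathbb{Z}_n)$ can be written as a product of at most $c\,m^2$ symplectic row operations acting on $\mathrm{Sp}_{2m}(\mathbb{Z}_n)$. That is, $S$ decomposes into $O(m^2)$ symplectic row operations, with a bound independent of the modulus $n$.
   Context: Let $\sigma_{2m} = \begin{bmatrix} 0_m & -I_m \\ I_m & 0_m\end{bmatrix}$. $\mathrm{Sp}_{2m}(\mathbb{Z}_n)$ is the group of $2m\times 2m$ matrices $S$ over $\mathbb{Z}_n$ with $S^{T}\sigma_{2m}S = \sigma_{2m}$. Rows are indexed by $1,\dots,2m$, with indices taken modulo $2m$ (so $j+m$ denotes the row in the other half corresponding to $j$). All operators below are matrices in $\mathrm{GL}_{2m}(\mathbb{Z}_n)$ described by their action by left multiplication: $\mu_j^{(\alpha)}$ multiplies row $j$ by the unit $\alpha\in\mathbb{Z}_n^\times$; $\epsilon_{j,k}$ exchanges rows $j$ and $k$; $\chi_{j,k}$ adds row $j$ to row $k$ ($j\neq k$). The symplectic row operations are the following operators, for row indices $j \ne k$ and units $\alpha$, together with the inverses $C_{j,k}^{ -1}$: (1) $M_j^{(\alpha)} = \mu_j^{(\alpha)}\mu_{j+m}^{(\alpha^{ -1})}$; (2) $E_{j,k} = \epsilon_{j,k}\,\mu_k^{(-1)}$ if $j-k\equiv m \pmod{2m}$, and $E_{j,k} = \epsilon_{j,k}\,\epsilon_{j+m,k+m}$ otherwise; (3) $C_{j,k} = \chi_{j,k}$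 if $j-k\equiv m \pmod{2m}$; $C_{j,k} = \chi_{j,k}\,\chi_{k+m,j+m}^{ -1}$ if $1\le j,k\le m$ or $m+1\le j,k\le 2m$; and $C_{j,k} = \chi_{j,k}\,\chi_{k+m,j+m}$ otherwise. -}

module Defs where

open import Algebra.Bundles using (CommutativeRing; Group; Monoid)
import Algebra.Properties.Ring as RingProperties
import Algebra.Properties.Semiring.Sum as SemiringSum
open import Data.Bool.Base using (Bool; true; false; if_then_else_)
open import Data.Fin.Base using (Fin; zero; suc; splitAt; join)
open import Data.Fin.Permutation.Components using (transpose; transpose-inverse)
open import Data.Fin.Properties using (_≟_; splitAt-join; join-splitAt)
open import Data.Integer.Base as ℤ using (ℤ; +_)
open import Data.Integer.Divisibility.Signed using (_∣_; divides)
import Data.Integer.Properties as ℤ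
open import Data.Integer.Tactic.RingSolver using (solve-∀)
open import Data.List.Base using (List; foldr; map)
open import Data.Nat.Base using (ℕ) renaming (_+_ to _ℕ+_)
open import Data.Product.Base using (_,_)
open import Data.Sum.Base using (inj₁; inj₂; swap)
open import Data.Sum.Properties using (swap-involutive)
open import Data.Vec.Functional using (Vector)
open import Function.Base using (_∘_)
open import Level using (0ℓ; _⊔_)
open import Relation.Binary.PropositionalEquality as ≡ using (_≡_; _≢_)
import Relation.Binary.Reasoning.Setoid as SetoidReasoning
open import Relation.Nullary.Decidable using (does; yes; no)
open import Relation.Nullary.Negation using (contradiction)

------------------------------------------------------------------------
-- The group of units of a monoid

module _ {a ℓ} (M : Monoid a ℓ) where
  open Monoid M
  open SetoidReasoning setoid

  record Unit : Set (a ⊔ ℓ) where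
    field
      value     : Carrier
      inverse   : Carrier
      inverse-l : inverse ∙ value ≈ ε
      inverse-r : value ∙ inverse ≈ ε

  open Unit

  private
    cancel : ∀ x y z w → y ∙ z ≈ ε → x ∙ w ≈ ε → (x ∙ y) ∙ (z ∙ w) ≈ ε
    cancel x y z w yz≈ε xw≈ε = begin
      (x ∙ y) ∙ (z ∙ w)  ≈⟨ assoc x y (z ∙ w) ⟩
      x ∙ (y ∙ (z ∙ w))  ≈⟨ ∙-congˡ (assoc y z w) ⟨
      x ∙ ((y ∙ z) ∙ w)  ≈⟨ ∙-congˡ (∙-congʳ yz≈ε) ⟩
      x ∙ (ε ∙ w)        ≈⟨ ∙-congˡ (identityˡ w) ⟩
      x ∙ w              ≈⟨ xw≈ε ⟩
      ε                  ∎

    inverse-cong : ∀ u v → value u ≈ value v → inverse u ≈ inverse v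
    inverse-cong u v u≈v = begin
      inverse u                          ≈⟨ identityʳ _ ⟨
      inverse u ∙ ε                      ≈⟨ ∙-congˡ (inverse-r v) ⟨
      inverse u ∙ (value v ∙ inverse v)  ≈⟨ assoc _ _ _ ⟨
      (inverse u ∙ value v) ∙ inverse v  ≈⟨ ∙-congʳ (∙-congˡ u≈v) ⟨
      (inverse u ∙ value u) ∙ inverse v  ≈⟨ ∙-congʳ (inverse-l u) ⟩
      ε ∙ inverse v                      ≈⟨ identityˡ _ ⟩
      inverse v                          ∎

  unitGroup : Group (a ⊔ ℓ) ℓ
  unitGroup = record
    { Carrier = Unit
    ; _≈_     = λ u v → value u ≈ value v
    ; _∙_     = λ u v → record
      { value     = value u ∙ value v
      ; inverse   = inverse v ∙ inverse u
      ; inverse-l = cancel _ _ _ _ (inverse-l u) (inverse-l v)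
      ; inverse-r = cancel _ _ _ _ (inverse-r v) (inverse-r u)
      }
    ; ε       = record
      { value     = ε
      ; inverse   = ε
      ; inverse-l = identityˡ ε
      ; inverse-r = identityˡ ε
      }
    ; _⁻¹     = λ u → record
      { value     = inverse u
      ; inverse   = value u
      ; inverse-l = inverse-r u
      ; inverse-r = inverse-l u
      }
    ; isGroup = record
      { isMonoid = record
        { isSemigroup = record
          { isMagma = record
            { isEquivalence = record { refl = refl ; sym = sym ; trans = trans }
            ; ∙-cong        = ∙-cong
            }
          ; assoc   = λ u v w → assoc (value u) (value v) (value w)
          }
        ; identity    = (λ u → identityˡ (value u)) , (λ u → identityʳ (value u))
        }
      ; inverse  = inverse-l , inverse-r
      ; ⁻¹-cong  = λ {u} {v} → inverse-cong u v
      }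
    }

------------------------------------------------------------------------
-- The ring of integers modulo n: integers up to congruence.  Here n = 0
-- is allowed and gives ℤ itself.

module _ (n : ℕ) where

  -- A record rather than a synonym, so that a and b can be inferred.
  infix 4 _≡ₙ_
  record _≡ₙ_ (a b : ℤ) : Set where
    constructor congruent
    field n∣a-b : + n ∣ a ℤ.- b

  private
    by : ∀ {a b} (q : ℤ) → a ℤ.- b ≡ q ℤ.* + n → a ≡ₙ b
    by q eq = congruent (divides q eq)

    reflexive : ∀ {a b} → a ≡ b → a ≡ₙ b
    reflexive a≡b = by (+ 0) (ℤ.i≡j⇒i-j≡0 a≡b)

    symmetric : ∀ {a b} → a ≡ₙ b → b ≡ₙ a
    symmetric {a} {b} (congruent (divides q eq)) = by (ℤ.- q)
      (≡.trans (e₁ a b) (≡.trans (≡.cong ℤ.-_ eq) (e₂ q (+ n))))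
      where
      e₁ : ∀ a b → b ℤ.- a ≡ ℤ.- (a ℤ.- b)
      e₁ = solve-∀
      e₂ : ∀ q m → ℤ.- (q ℤ.* m) ≡ ℤ.- q ℤ.* m
      e₂ = solve-∀

    transitive : ∀ {a b c} → a ≡ₙ b → b ≡ₙ c → a ≡ₙ c
    transitive {a} {b} {c} (congruent (divides q eq)) (congruent (divides r eq′)) =
      by (q ℤ.+ r)
      (≡.trans (e₁ a b c) (≡.trans (≡.cong₂ ℤ._+_ eq eq′) (e₂ q r (+ n))))
      where
      e₁ : ∀ a b c → a ℤ.- c ≡ (a ℤ.- b) ℤ.+ (b ℤ.- c)
      e₁ = solve-∀
      e₂ : ∀ q r m → q ℤ.* m ℤ.+ r ℤ.* m ≡ (q ℤ.+ r) ℤ.* m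
      e₂ = solve-∀

    +-cong : ∀ {a b c d} → a ≡ₙ b → c ≡ₙ d → a ℤ.+ c ≡ₙ b ℤ.+ d
    +-cong {a} {b} {c} {d} (congruent (divides q eq)) (congruent (divides r eq′)) =
      by (q ℤ.+ r)
      (≡.trans (e₁ a b c d) (≡.trans (≡.cong₂ ℤ._+_ eq eq′) (e₂ q r (+ n))))
      where
      e₁ : ∀ a b c d → (a ℤ.+ c) ℤ.- (b ℤ.+ d) ≡ (a ℤ.- b) ℤ.+ (c ℤ.- d)
      e₁ = solve-∀
      e₂ : ∀ q r m → q ℤ.* m ℤ.+ r ℤ.* m ≡ (q ℤ.+ r) ℤ.* m
      e₂ = solve-∀

    *-cong : ∀ {a b c d} → a ≡ₙ b → c ≡ₙ d → a ℤ.* c ≡ₙ b ℤ.* d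
    *-cong {a} {b} {c} {d} (congruent (divides q eq)) (congruent (divides r eq′)) =
      by (q ℤ.* c ℤ.+ b ℤ.* r)
      (≡.trans (e₁ a b c d)
        (≡.trans (≡.cong₂ (λ x y → x ℤ.* c ℤ.+ b ℤ.* y) eq eq′) (e₂ q r (+ n) b c)))
      where
      e₁ : ∀ a b c d → a ℤ.* c ℤ.- b ℤ.* d ≡ (a ℤ.- b) ℤ.* c ℤ.+ b ℤ.* (c ℤ.- d)
      e₁ = solve-∀
      e₂ : ∀ q r m b c → q ℤ.* m ℤ.* c ℤ.+ b ℤ.* (r ℤ.* m) ≡ (q ℤ.* c ℤ.+ b ℤ.* r) ℤ.* m
      e₂ = solve-∀

    neg-cong : ∀ {a b} → a ≡ₙ b → ℤ.- a ≡ₙ ℤ.- b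
    neg-cong {a} {b} (congruent (divides q eq)) = by (ℤ.- q)
      (≡.trans (e₁ a b) (≡.trans (≡.cong ℤ.-_ eq) (e₂ q (+ n))))
      where
      e₁ : ∀ a b → ℤ.- a ℤ.- (ℤ.- b) ≡ ℤ.- (a ℤ.- b)
      e₁ = solve-∀
      e₂ : ∀ q m → ℤ.- (q ℤ.* m) ≡ ℤ.- q ℤ.* m
      e₂ = solve-∀

  ℤ/_ : CommutativeRing 0ℓ 0ℓ
  ℤ/_ = record
    { Carrier = ℤ
    ; _≈_     = _≡ₙ_
    ; _+_     = ℤ._+_
    ; _*_     = ℤ._*_
    ; -_      = ℤ.-_
    ; 0#      = + 0
    ; 1#      = + 1
    ; isCommutativeRing = record
      { isRing = record
        { +-isAbelianGroup = record
          { isGroup = record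
            { isMonoid = record
              { isSemigroup = record
                { isMagma = record
                  { isEquivalence = record
                    { refl  = reflexive ≡.refl
                    ; sym   = symmetric
                    ; trans = transitive
                    }
                  ; ∙-cong        = +-cong
                  }
                ; assoc   = λ a b c → reflexive (ℤ.+-assoc a b c)
                }
              ; identity    = (λ a → reflexive (ℤ.+-identityˡ a))
                            , (λ a → reflexive (ℤ.+-identityʳ a))
              }
            ; inverse  = (λ a → reflexive (ℤ.+-inverseˡ a))
                       , (λ a → reflexive (ℤ.+-inverseʳ a))
            ; ⁻¹-cong  = neg-cong
            }
          ; comm    = λ a b → reflexive (ℤ.+-comm a b)
          }
        ; *-cong     = *-cong
        ; *-assoc    = λ a b c → reflexive (ℤ.*-assoc a b c)
        ; *-identity = (λ a → reflexive (ℤ.*-identityˡ a))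
                     , (λ a → reflexive (ℤ.*-identityʳ a))
        ; distrib    = (λ a b c → reflexive (ℤ.*-distribˡ-+ a b c))
                     , (λ a b c → reflexive (ℤ.*-distribʳ-+ a b c))
        }
      ; *-comm = λ a b → reflexive (ℤ.*-comm a b)
      }
    }

------------------------------------------------------------------------
-- Square matrices over a commutative ring

module Matrices {c ℓ} (R : CommutativeRing c ℓ) (d : ℕ) where
  open CommutativeRing R
  open SemiringSum semiring
    using (sum; sum-cong-≋; *-distribˡ-sum; *-distribʳ-sum; ∑-comm; ∑-distrib-+)
  open RingProperties ring using (-‿involutive; -1*x≈-x)
  open SetoidReasoning setoid

  Matrix : Set c
  Matrix = Fin d → Fin d → Carrier

  infix 4 _≋_
  _≋_ : Matrix → Matrix → Set ℓ
  A ≋ B = ∀ i j → A i j ≈ B i j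

  infixl 7 _·_
  _·_ : Matrix → Matrix → Matrix
  (A · B) i j = sum λ t → A i t * B t j

  infix 8 _ᵀ
  _ᵀ : Matrix → Matrix
  (A ᵀ) i j = A j i

  δ : ∀ {k} → Fin k → Fin k → Carrier
  δ i j = if does (i ≟ j) then 1# else 0#

  𝟙 : Matrix
  𝟙 = δ

  private
    sum-zero : ∀ {k} (f : Vector Carrier k) → sum (λ t → 0# * f t) ≈ 0#
    sum-zero f = trans (sym (*-distribˡ-sum 0# f)) (zeroˡ _)

    sum-δ : ∀ {k} (i : Fin k) (f : Vector Carrier k) → sum (λ t → δ i t * f t) ≈ f i
    sum-δ zero    f = trans (+-cong (*-identityˡ _) (sum-zero (f ∘ suc))) (+-identityʳ _)
    sum-δ (suc i) f = trans (+-cong (zeroˡ _) (sum-δ i (f ∘ suc))) (+-identityˡ _)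

    δ-sym : ∀ {k} (i j : Fin k) → δ i j ≡ δ j i
    δ-sym zero    zero    = ≡.refl
    δ-sym zero    (suc j) = ≡.refl
    δ-sym (suc i) zero    = ≡.refl
    δ-sym (suc i) (suc j) = δ-sym i j

  ·-cong : ∀ {A B C D} → A ≋ B → C ≋ D → A · C ≋ B · D
  ·-cong A≋B C≋D i j = sum-cong-≋ λ t → *-cong (A≋B i t) (C≋D t j)

  ·-identityˡ : ∀ A → 𝟙 · A ≋ A
  ·-identityˡ A i j = sum-δ i λ t → A t j

  ·-identityʳ : ∀ A → A · 𝟙 ≋ A
  ·-identityʳ A i j = trans
    (sum-cong-≋ λ t → trans (*-comm _ _) (*-congʳ (reflexive (δ-sym t j))))
    (sum-δ j (A i))

  ·-assoc : ∀ A B C → (A · B) · C ≋ A · (B · C)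
  ·-assoc A B C i j = begin
    sum (λ t → sum (λ s → A i s * B s t) * C t j)
      ≈⟨ sum-cong-≋ (λ t → *-distribʳ-sum (C t j) (λ s → A i s * B s t)) ⟩
    sum (λ t → sum (λ s → (A i s * B s t) * C t j))
      ≈⟨ ∑-comm (λ t s → (A i s * B s t) * C t j) ⟩
    sum (λ s → sum (λ t → (A i s * B s t) * C t j))
      ≈⟨ sum-cong-≋ (λ s → sum-cong-≋ (λ t → *-assoc (A i s) (B s t) (C t j))) ⟩
    sum (λ s → sum (λ t → A i s * (B s t * C t j)))
      ≈⟨ sum-cong-≋ (λ s → sym (*-distribˡ-sum (A i s) (λ t → B s t * C t j))) ⟩
    sum (λ s → A i s * sum (λ t → B s t * C t j))
      ∎

  matrixMonoid : Monoid c ℓ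
  matrixMonoid = record
    { Carrier  = Matrix
    ; _≈_      = _≋_
    ; _∙_      = _·_
    ; ε        = 𝟙
    ; isMonoid = record
      { isSemigroup = record
        { isMagma = record
          { isEquivalence = record
            { refl  = λ i j → refl
            ; sym   = λ A≋B i j → sym (A≋B i j)
            ; trans = λ A≋B B≋C i j → trans (A≋B i j) (B≋C i j)
            }
          ; ∙-cong        = ·-cong
          }
        ; assoc   = ·-assoc
        }
      ; identity    = ·-identityˡ , ·-identityʳ
      }
    }

  GL : Group (c ⊔ ℓ) ℓ
  GL = unitGroup matrixMonoid

  R× : Group (c ⊔ ℓ) ℓ
  R× = unitGroup *-monoid

  -- Row operations on matrices.  Each is left multiplication by the
  -- matrix obtained by applying it to 𝟙; see the lemmas below.

  scaleRow : Fin d → Carrier → Matrix → Matrix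
  scaleRow j a A i l = if does (i ≟ j) then a * A i l else A i l

  swapRows : Fin d → Fin d → Matrix → Matrix
  swapRows j k A i l = A (transpose j k i) l

  -- Add a times row j to row k.
  addRow : Carrier → Fin d → Fin d → Matrix → Matrix
  addRow a j k A i l = if does (i ≟ k) then A i l + a * A j l else A i l

  scaleRow-· : ∀ j a A → scaleRow j a 𝟙 · A ≋ scaleRow j a A
  scaleRow-· j a A i l with does (i ≟ j)
  ... | false = ·-identityˡ A i l
  ... | true  = begin
    sum (λ t → (a * δ i t) * A t l)  ≈⟨ sum-cong-≋ (λ t → *-assoc a (δ i t) (A t l)) ⟩
    sum (λ t → a * (δ i t * A t l))  ≈⟨ *-distribˡ-sum a (λ t → δ i t * A t l) ⟨
    a * sum (λ t → δ i t * A t l)    ≈⟨ *-congˡ (·-identityˡ A i l) ⟩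
    a * A i l                        ∎

  swapRows-· : ∀ j k A → swapRows j k 𝟙 · A ≋ swapRows j k A
  swapRows-· j k A i l = ·-identityˡ A (transpose j k i) l

  addRow-· : ∀ a j k A → addRow a j k 𝟙 · A ≋ addRow a j k A
  addRow-· a j k A i l with does (i ≟ k)
  ... | false = ·-identityˡ A i l
  ... | true  = begin
    sum (λ t → (δ i t + a * δ j t) * A t l)
      ≈⟨ sum-cong-≋ (λ t → trans (distribʳ (A t l) (δ i t) (a * δ j t))
                                 (+-congˡ (*-assoc a (δ j t) (A t l)))) ⟩
    sum (λ t → δ i t * A t l + a * (δ j t * A t l))
      ≈⟨ ∑-distrib-+ (λ t → δ i t * A t l) (λ t → a * (δ j t * A t l)) ⟩
    sum (λ t → δ i t * A t l) + sum (λ t → a * (δ j t * A t l))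
      ≈⟨ +-cong (·-identityˡ A i l) (sym (*-distribˡ-sum a (λ t → δ j t * A t l))) ⟩
    A i l + a * sum (λ t → δ j t * A t l)
      ≈⟨ +-congˡ (*-congˡ (·-identityˡ A j l)) ⟩
    A i l + a * A j l
      ∎

  private
    scaleRow-inverse : ∀ j a b → a * b ≈ 1# →
                       scaleRow j a 𝟙 · scaleRow j b 𝟙 ≋ 𝟙
    scaleRow-inverse j a b ab≈1 i l = trans (scaleRow-· j a (scaleRow j b 𝟙) i l) go
      where
      go : scaleRow j a (scaleRow j b 𝟙) i l ≈ 𝟙 i l
      go with does (i ≟ j)
      ... | false = refl
      ... | true  = trans (sym (*-assoc _ _ _)) (trans (*-congʳ ab≈1) (*-identityˡ _))

    swapRows-inverse : ∀ j k → swapRows j k 𝟙 · swapRows k j 𝟙 ≋ 𝟙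
    swapRows-inverse j k i l = trans (swapRows-· j k (swapRows k j 𝟙) i l)
      (reflexive (≡.cong (λ t → 𝟙 t l) (transpose-inverse k j {i})))

    addRow-inverse : ∀ {j k} → j ≢ k → ∀ a b → b + a ≈ 0# →
                     addRow a j k 𝟙 · addRow b j k 𝟙 ≋ 𝟙
    addRow-inverse {j} {k} j≢k a b b+a≈0 i l = trans (addRow-· a j k (addRow b j k 𝟙) i l) go
      where
      go : addRow a j k (addRow b j k 𝟙) i l ≈ 𝟙 i l
      go with does (i ≟ k)
      ... | false = refl
      ... | true with j ≟ k
      ...   | yes j≡k = contradiction j≡k j≢k
      ...   | no  _   = begin
        (δ i l + b * δ j l) + a * δ j l  ≈⟨ +-assoc _ _ _ ⟩
        δ i l + (b * δ j l + a * δ j l)  ≈⟨ +-congˡ (distribʳ _ _ _) ⟨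
        δ i l + (b + a) * δ j l          ≈⟨ +-congˡ (*-congʳ b+a≈0) ⟩
        δ i l + 0# * δ j l               ≈⟨ +-congˡ (zeroˡ _) ⟩
        δ i l + 0#                       ≈⟨ +-identityʳ _ ⟩
        δ i l                            ∎

  -1× : Group.Carrier R×
  -1× = record
    { value     = - 1#
    ; inverse   = - 1#
    ; inverse-l = -1*-1≈1
    ; inverse-r = -1*-1≈1
    }
    where
    -1*-1≈1 : - 1# * - 1# ≈ 1#
    -1*-1≈1 = trans (-1*x≈-x (- 1#)) (-‿involutive 1#)

  μ : Fin d → Group.Carrier R× → Group.Carrier GL
  μ j α = record
    { value     = scaleRow j (Unit.value α) 𝟙
    ; inverse   = scaleRow j (Unit.inverse α) 𝟙
    ; inverse-l = scaleRow-inverse j _ _ (Unit.inverse-l α)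
    ; inverse-r = scaleRow-inverse j _ _ (Unit.inverse-r α)
    }

  ε : Fin d → Fin d → Group.Carrier GL
  ε j k = record
    { value     = swapRows j k 𝟙
    ; inverse   = swapRows k j 𝟙
    ; inverse-l = swapRows-inverse k j
    ; inverse-r = swapRows-inverse j k
    }

  χ : ∀ j k → j ≢ k → Group.Carrier GL
  χ j k j≢k = record
    { value     = addRow 1# j k 𝟙
    ; inverse   = addRow (- 1#) j k 𝟙
    ; inverse-l = addRow-inverse j≢k (- 1#) 1# (-‿inverseʳ 1#)
    ; inverse-r = addRow-inverse j≢k 1# (- 1#) (-‿inverseˡ 1#)
    }

------------------------------------------------------------------------
-- Symplectic matrices and symplectic row operations.  Row indices are
-- 0-based, so the two halves are 0, …, m-1 and m, …, 2m-1.

module Symplectic {c ℓ} (R : CommutativeRing c ℓ) (m : ℕ) where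
  open CommutativeRing R using (0#; -_)
  open Matrices R (m ℕ+ m) public
  open Group GL using (_∙_; _⁻¹) renaming (ε to 1GL)

  Index : Set
  Index = Fin (m ℕ+ m)

  σ : Matrix
  σ i j with splitAt m i | splitAt m j
  ... | inj₁ _ | inj₁ _ = 0#
  ... | inj₁ a | inj₂ b = - δ a b
  ... | inj₂ a | inj₁ b = δ a b
  ... | inj₂ _ | inj₂ _ = 0#

  IsSymplectic : Matrix → Set ℓ
  IsSymplectic S = S ᵀ · σ · S ≋ σ

  record Sp : Set (c ⊔ ℓ) where
    field
      matrix       : Matrix
      isSymplectic : IsSymplectic matrix

  -- Adding m modulo 2m exchanges the two halves of the index set.
  infix 8 _+m
  _+m : Index → Index
  j +m = join m m (swap (splitAt m j))

  +m-involutive : ∀ j → (j +m) +m ≡ j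
  +m-involutive j = begin
    join m m (swap (splitAt m (join m m (swap (splitAt m j)))))
      ≡⟨ ≡.cong (join m m ∘ swap) (splitAt-join m m (swap (splitAt m j))) ⟩
    join m m (swap (swap (splitAt m j)))
      ≡⟨ ≡.cong (join m m) (swap-involutive (splitAt m j)) ⟩
    join m m (splitAt m j)
      ≡⟨ join-splitAt m m j ⟩
    j ∎
    where open ≡.≡-Reasoning

  +m-distinct : ∀ {j k} → j ≢ k → k +m ≢ j +m
  +m-distinct {j} {k} j≢k eq = j≢k
    (≡.trans (≡.sym (+m-involutive j))
      (≡.trans (≡.cong _+m (≡.sym eq)) (+m-involutive k)))

  sameHalf : Index → Index → Bool
  sameHalf j k with splitAt m j | splitAt m k
  ... | inj₁ _ | inj₁ _ = true
  ... | inj₁ _ | inj₂ _ = false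
  ... | inj₂ _ | inj₁ _ = false
  ... | inj₂ _ | inj₂ _ = true

  -- In E and C the condition j - k ≡ m (mod 2m) is tested as j ≡ k +m.

  M : Index → Group.Carrier R× → Group.Carrier GL
  M j α = μ j α ∙ μ (j +m) (Group._⁻¹ R× α)

  E : Index → Index → Group.Carrier GL
  E j k = if does (j ≟ k +m)
          then ε j k ∙ μ k -1×
          else ε j k ∙ ε (j +m) (k +m)

  C : ∀ j k → j ≢ k → Group.Carrier GL
  C j k j≢k = if does (j ≟ k +m)
              then χ j k j≢k
              else if sameHalf j k
              then χ j k j≢k ∙ χ (k +m) (j +m) (+m-distinct j≢k) ⁻¹
              else χ j k j≢k ∙ χ (k +m) (j +m) (+m-distinct j≢k)

  data RowOperation : Set (c ⊔ ℓ) where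
    opM   : (j : Index) (α : Group.Carrier R×) → RowOperation
    opE   : (j k : Index) → j ≢ k → RowOperation
    opC   : (j k : Index) → j ≢ k → RowOperation
    opC⁻¹ : (j k : Index) → j ≢ k → RowOperation

  ⟦_⟧ : RowOperation → Group.Carrier GL
  ⟦ opM j α ⟧       = M j α
  ⟦ opE j k _ ⟧     = E j k
  ⟦ opC j k j≢k ⟧   = C j k j≢k
  ⟦ opC⁻¹ j k j≢k ⟧ = C j k j≢k ⁻¹

  -- E j k exchanges two hyperbolic pairs with their halves reversed when
  -- j and k lie in different halves and j ≢ k +m; that sends σ-values to
  -- their negatives, so it is not symplectic unless 1 + 1 ≈ 0.  Acting on
  -- the symplectic group is therefore a genuine condition on an operation.
  ActsOnSp : RowOperation → Set ℓ
  ActsOnSp op = IsSymplectic (Unit.value ⟦ op ⟧)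

  -- product (T₁ ∷ … ∷ Tᵣ ∷ []) is the matrix product T₁ ⋯ Tᵣ.
  product : List RowOperation → Group.Carrier GL
  product ops = foldr _∙_ 1GL (map ⟦_⟧ ops)

{-# OPTIONS --safe #-}
module Submission where

-- Two columns p and p + m of S pair to ± 1 under the symplectic form.  As ℤ/n
-- has stable range 1, one unipotent T p t c of Heisenberg type therefore turns
-- a chosen entry into a unit, and four more reduce the two columns to basis
-- vectors.  By symplecticity the corresponding rows are then trivial as well,
-- so that the reduction of other columns leaves these alone, and O(m) unipotents
-- reduce S to the identity.
--
-- A unipotent is a product of O(m) elementary ones T p (a e_j) 0 and T p 0 a.
-- Conjugation by M rescales a by a unit, but by the square of a unit in the
-- case of T p 0 a.  The bound is uniform in n because every a in ℤ/n is a
-- sum of at most 27 terms ± u² with u a unit: write a = r + 24 b, use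
-- 24 x = (6x + 1)² - (6x - 1)² for x and b - x, and choose x modulo each prime
-- divisor of n such that all four bases are units.

open import Defs
open import Algebra.Bundles using (CommutativeRing; Group)
import Algebra.Properties.Ring as RingProperties
import Algebra.Properties.Semiring.Mult.TCOptimised as SemiringMult
import Algebra.Properties.Semiring.Sum as SemiringSum
import Algebra.Solver.Ring
open import Algebra.Solver.Ring.AlmostCommutativeRing using (fromCommutativeRing; _-Raw-AlmostCommutative⟶_)
open import Data.Bool.Base using (true; false; if_then_else_)
open import Data.Fin.Base using (Fin; zero; suc; splitAt; join; _↑ˡ_; _↑ʳ_)
open import Data.Fin.Properties using (_≟_; join-splitAt; ↑ʳ-injective; ↑ˡ-injective; splitAt-↑ˡ; splitAt-↑ʳ)
open import Data.Integer.Base as ℤ using (ℤ; +_; -[1+_]; _⊖_)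
import Data.Integer.DivMod as ℤ
open import Data.Integer.Divisibility.Signed as ℤ using (_∣_; divides)
import Data.Integer.Properties as ℤ
import Data.Integer.Tactic.RingSolver as ℤ-Solver
open import Data.List.Base using (List; []; _∷_; _++_; length)
import Data.List.Properties as List
open import Data.List.Relation.Unary.All using (All; []; _∷_)
import Data.List.Relation.Unary.All.Properties as All
open import Data.Maybe.Base using (Maybe; just; nothing)
open import Data.Nat.Base as ℕ using (ℕ; zero; suc; NonZero; _≤_; _<_)
import Data.Nat.Coprimality as ℕ
import Data.Nat.Divisibility as ℕ
open import Data.Nat.GCD using (module Bézout)
import Data.Nat.ListAction as ℕ
import Data.Nat.Primality as ℕ
open import Data.Nat.Primality using (Prime)
open import Data.Nat.Primality.Factorisation using (factorise)
import Data.Nat.Properties as ℕ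
import Data.Nat.Tactic.RingSolver as ℕ-Solver
open import Data.Product.Base using (∃-syntax; _×_; _,_; proj₁; proj₂)
open import Data.Sum.Base using (_⊎_; inj₁; inj₂)
open import Function.Base using (id; _∘_)
open import Level using (_⊔_)
open import Relation.Binary.PropositionalEquality as ≡ using (_≡_; _≢_)
import Relation.Binary.Reasoning.Setoid as SetoidReasoning
open import Relation.Nullary.Decidable using (does; yes; no; dec-true; dec-false)
open import Relation.Nullary.Negation using (¬_; contradiction)

-- The obstacle is uniformity in `n`. Repeating `C` adds a row `a` times at cost `a`, and clearing a
-- column by Euclid's algorithm takes a number of steps that grows with `n`. Both are replaced by
-- units: stable range 1 produces a pivot without any gcd computation, and sums of unit squares
-- produce every coefficient at bounded cost.
--
-- The number 24 comes from the primes 2 and 3, which have too few residues for four values to be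
-- avoided. The bases `6x ± 1` are prime to 6 automatically, and the difference of their squares is
-- `24x`. Taking `x = b` alone would leave no freedom to make the bases units; splitting `b` into
-- `x` and `b - x` gains a free parameter. For a prime `p ≥ 5` the four linear factors exclude at
-- most four residues of `x`, so that one is always left.

-- The solver needs coefficients with decidable equality to cancel terms,
-- hence the homomorphism from ℤ.
module IntegerSolver {c ℓ} (R : CommutativeRing c ℓ) where
  open CommutativeRing R hiding (zero)
  open RingProperties ring
  open SemiringMult semiring renaming (_×_ to _×ₙ_)
  open SetoidReasoning setoid

  -- With the optimised multiple, `fromℤ (+ 1)` reduces to `1#`, so that `con (+ 1)` matches `1#` in
  -- a goal definitionally.
  fromℤ : ℤ → Carrier
  fromℤ (+ n)    = n ×ₙ 1#
  fromℤ -[1+ n ] = - (suc n ×ₙ 1#)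

  private
    fromℤ-neg : ∀ a → fromℤ (ℤ.- a) ≈ - fromℤ a
    fromℤ-neg (+ zero)  = sym -0#≈0#
    fromℤ-neg (+ suc n) = refl
    fromℤ-neg -[1+ n ]  = sym (-‿involutive _)

    suc-× : ∀ n → suc n ×ₙ 1# ≈ 1# + n ×ₙ 1#
    suc-× n = ×-homo-+ 1# 1 n

    fromℤ-⊖ : ∀ m n → fromℤ (m ⊖ n) ≈ m ×ₙ 1# - n ×ₙ 1#
    fromℤ-⊖ zero    zero    = sym (-‿inverseʳ 0#)
    fromℤ-⊖ zero    (suc n) = sym (+-identityˡ _)
    fromℤ-⊖ (suc m) zero    = sym (trans (+-congˡ -0#≈0#) (+-identityʳ _))
    fromℤ-⊖ (suc m) (suc n) = begin
      fromℤ (suc m ⊖ suc n)                  ≡⟨ ≡.cong fromℤ (ℤ.[1+m]⊖[1+n]≡m⊖n m n) ⟩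
      fromℤ (m ⊖ n)                          ≈⟨ fromℤ-⊖ m n ⟩
      m ×ₙ 1# - n ×ₙ 1#                        ≈⟨ +-congˡ (+-identityˡ _) ⟨
      m ×ₙ 1# + (0# + - (n ×ₙ 1#))             ≈⟨ +-congˡ (+-congʳ (-‿inverseʳ 1#)) ⟨
      m ×ₙ 1# + ((1# - 1#) + - (n ×ₙ 1#))      ≈⟨ +-congˡ (+-assoc _ _ _) ⟩
      m ×ₙ 1# + (1# + (- 1# + - (n ×ₙ 1#)))    ≈⟨ +-assoc _ _ _ ⟨
      (m ×ₙ 1# + 1#) + (- 1# + - (n ×ₙ 1#))    ≈⟨ +-cong (+-comm _ _) (-‿+-comm 1# (n ×ₙ 1#)) ⟩
      (1# + m ×ₙ 1#) - (1# + n ×ₙ 1#)          ≈⟨ +-cong (suc-× m) (-‿cong (suc-× n)) ⟨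
      suc m ×ₙ 1# - suc n ×ₙ 1#                ∎

    fromℤ-+ : ∀ a b → fromℤ (a ℤ.+ b) ≈ fromℤ a + fromℤ b
    fromℤ-+ (+ m)    (+ n)    = ×-homo-+ 1# m n
    fromℤ-+ (+ m)    -[1+ n ] = fromℤ-⊖ m (suc n)
    fromℤ-+ -[1+ m ] (+ n)    = trans (fromℤ-⊖ n (suc m)) (+-comm _ _)
    fromℤ-+ -[1+ m ] -[1+ n ] = begin
      - (suc (suc (m ℕ.+ n)) ×ₙ 1#)       ≡⟨ ≡.cong (λ k → - (suc k ×ₙ 1#)) (≡.sym (ℕ.+-suc m n)) ⟩
      - ((suc m ℕ.+ suc n) ×ₙ 1#)         ≈⟨ -‿cong (×-homo-+ 1# (suc m) (suc n)) ⟩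
      - (suc m ×ₙ 1# + suc n ×ₙ 1#)        ≈⟨ -‿+-comm _ _ ⟨
      - (suc m ×ₙ 1#) + - (suc n ×ₙ 1#)    ∎

    fromℤ-* : ∀ a b → fromℤ (a ℤ.* b) ≈ fromℤ a * fromℤ b
    fromℤ-*⁺ : ∀ m b → fromℤ (+ m ℤ.* b) ≈ fromℤ (+ m) * fromℤ b
    fromℤ-*⁺ m (+ n)    = trans (reflexive (≡.cong fromℤ (≡.sym (ℤ.pos-* m n)))) (×1-homo-* m n)
    fromℤ-*⁺ m -[1+ n ] = begin
      fromℤ (+ m ℤ.* ℤ.- + suc n)     ≡⟨ ≡.cong fromℤ (≡.sym (ℤ.neg-distribʳ-* (+ m) (+ suc n))) ⟩
      fromℤ (ℤ.- (+ m ℤ.* + suc n))   ≈⟨ fromℤ-neg (+ m ℤ.* + suc n) ⟩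
      - fromℤ (+ m ℤ.* + suc n)       ≈⟨ -‿cong (fromℤ-*⁺ m (+ suc n)) ⟩
      - (m ×ₙ 1# * suc n ×ₙ 1#)         ≈⟨ -‿distribʳ-* _ _ ⟩
      m ×ₙ 1# * - (suc n ×ₙ 1#)         ∎
    fromℤ-* (+ m)    b = fromℤ-*⁺ m b
    fromℤ-* -[1+ m ] b = begin
      fromℤ (ℤ.- + suc m ℤ.* b)      ≡⟨ ≡.cong fromℤ (≡.sym (ℤ.neg-distribˡ-* (+ suc m) b)) ⟩
      fromℤ (ℤ.- (+ suc m ℤ.* b))    ≈⟨ fromℤ-neg (+ suc m ℤ.* b) ⟩
      - fromℤ (+ suc m ℤ.* b)        ≈⟨ -‿cong (fromℤ-*⁺ (suc m) b) ⟩
      - (suc m ×ₙ 1# * fromℤ b)       ≈⟨ -‿distribˡ-* _ _ ⟩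
      - (suc m ×ₙ 1#) * fromℤ b       ∎

    homomorphism : ℤ.+-*-rawRing -Raw-AlmostCommutative⟶ fromCommutativeRing R
    homomorphism = record
      { ⟦_⟧    = fromℤ
      ; +-homo = fromℤ-+
      ; *-homo = fromℤ-*
      ; -‿homo = fromℤ-neg
      ; 0-homo = refl
      ; 1-homo = refl
      }

    weaklyDecide : ∀ a b → Maybe (fromℤ a ≈ fromℤ b)
    weaklyDecide a b with a ℤ.≟ b
    ... | yes a≡b = just (reflexive (≡.cong fromℤ a≡b))
    ... | no  _   = nothing

  open Algebra.Solver.Ring ℤ.+-*-rawRing (fromCommutativeRing R) homomorphism weaklyDecide public
    using (solve; _:=_; _:+_; _:*_; _:-_; :-_; con)

-- Sums of signed unit squares, and stable range 1

module UnitSquares {c ℓ} (R : CommutativeRing c ℓ) where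
  open CommutativeRing R hiding (zero)

  Unit× : Set (c ⊔ ℓ)
  Unit× = Unit *-monoid

  -- The index is only an upper bound for the number of terms, as `none` may end a sum at any `N`.
  data UnitSquareSum : ℕ → Carrier → Set (c ⊔ ℓ) where
    none : ∀ {N a} → a ≈ 0# → UnitSquareSum N a
    plus  : ∀ {N a b} (u : Unit×) → b ≈ Unit.value u * Unit.value u + a →
            UnitSquareSum N a → UnitSquareSum (suc N) b
    minus : ∀ {N a b} (u : Unit×) → b ≈ - (Unit.value u * Unit.value u) + a →
            UnitSquareSum N a → UnitSquareSum (suc N) b

  -- Equivalent to stable range 1: any c with a b + c ≈ 1# is 1# - a b.
  StableRange1 : Set (c ⊔ ℓ)
  StableRange1 = ∀ a b → ∃[ θ ] ∃[ u ] (a + θ * (1# - a * b)) * u ≈ 1#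

-- Invertibility of integers modulo a varying modulus

-- Formulated for integers rather than in `ℤ/ n`, since the same integer is considered modulo `n`,
-- modulo primes and modulo partial products of primes.
Invertible : ℕ → ℤ → Set
Invertible n z = ∃[ w ] + n ∣ z ℤ.* w ℤ.- + 1

invertible-cong : ∀ {n} x y → + n ∣ x ℤ.- y → Invertible n y → Invertible n x
invertible-cong {n} x y (divides q x-y≡qn) (w , divides r yw-1≡rn) =
  w , divides (q ℤ.* w ℤ.+ r) (≡.trans (lhs x y w)
    (≡.trans (≡.cong₂ (λ s t → s ℤ.* w ℤ.+ t) x-y≡qn yw-1≡rn) (rhs q r w (+ n))))
  where
  lhs : ∀ x y w → x ℤ.* w ℤ.- + 1 ≡ (x ℤ.- y) ℤ.* w ℤ.+ (y ℤ.* w ℤ.- + 1)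
  lhs = ℤ-Solver.solve-∀
  rhs : ∀ q r w n → q ℤ.* n ℤ.* w ℤ.+ r ℤ.* n ≡ (q ℤ.* w ℤ.+ r) ℤ.* n
  rhs = ℤ-Solver.solve-∀

invertible-factorˡ : ∀ {n} x y → Invertible n (x ℤ.* y) → Invertible n x
invertible-factorˡ {n} x y (w , n∣) = y ℤ.* w ,
  ≡.subst (λ t → + n ∣ t ℤ.- + 1) (ℤ.*-assoc x y w) n∣

invertible-factorʳ : ∀ {n} x y → Invertible n (x ℤ.* y) → Invertible n y
invertible-factorʳ {n} x y inv = invertible-factorˡ y x (≡.subst (Invertible n) (ℤ.*-comm x y) inv)

-- If `v` and `w` are the two inverses, `(z v - 1)(z w - 1)` is a multiple of `m n`, and expanding
-- it exhibits the new inverse. This covers moduli with a common factor, and therefore prime powers.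
invertible-* : ∀ m n z → Invertible m z → Invertible n z → Invertible (m ℕ.* n) z
invertible-* m n z (v , divides q eq) (w , divides r eq′) =
  v ℤ.+ w ℤ.- z ℤ.* v ℤ.* w , divides (ℤ.- (q ℤ.* r))
    (≡.trans (lhs z v w) (≡.trans (≡.cong₂ (λ s t → ℤ.- (s ℤ.* t)) eq eq′)
      (≡.trans (rhs q r (+ m) (+ n)) (≡.cong (ℤ.- (q ℤ.* r) ℤ.*_) (≡.sym (ℤ.pos-* m n))))))
  where
  lhs : ∀ z v w → z ℤ.* (v ℤ.+ w ℤ.- z ℤ.* v ℤ.* w) ℤ.- + 1
                ≡ ℤ.- ((z ℤ.* v ℤ.- + 1) ℤ.* (z ℤ.* w ℤ.- + 1))
  lhs = ℤ-Solver.solve-∀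
  rhs : ∀ q r m n → ℤ.- (q ℤ.* m ℤ.* (r ℤ.* n)) ≡ ℤ.- (q ℤ.* r) ℤ.* (m ℤ.* n)
  rhs = ℤ-Solver.solve-∀

coprime⇒invertible : ∀ {p r} → ℕ.Coprime p r → Invertible p (+ r)
coprime⇒invertible {p} {r} coprime with ℕ.coprime-Bézout coprime
... | Bézout.+- x y 1+yr≡xp = ℤ.- + y , divides (ℤ.- + x)
  (≡.trans (lhs (+ r) (+ y)) (≡.trans (≡.cong ℤ.-_ (cast y r x p 1+yr≡xp)) (ℤ.neg-distribˡ-* (+ x) (+ p))))
  where
  lhs : ∀ r y → r ℤ.* ℤ.- y ℤ.- + 1 ≡ ℤ.- (+ 1 ℤ.+ y ℤ.* r)
  lhs = ℤ-Solver.solve-∀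
  cast : ∀ a b c d → 1 ℕ.+ a ℕ.* b ≡ c ℕ.* d → + 1 ℤ.+ + a ℤ.* + b ≡ + c ℤ.* + d
  cast a b c d eq = ≡.trans (≡.cong (λ t → + 1 ℤ.+ t) (≡.sym (ℤ.pos-* a b)))
    (≡.trans (≡.cong +_ eq) (ℤ.pos-* c d))
... | Bézout.-+ x y 1+xp≡yr = + y , divides (+ x)
  (≡.trans (≡.cong (ℤ._- + 1) (≡.trans (ℤ.*-comm (+ r) (+ y)) (≡.sym (cast x p y r 1+xp≡yr)))) (lhs (+ x ℤ.* + p)))
  where
  lhs : ∀ t → + 1 ℤ.+ t ℤ.- + 1 ≡ t
  lhs = ℤ-Solver.solve-∀
  cast : ∀ a b c d → 1 ℕ.+ a ℕ.* b ≡ c ℕ.* d → + 1 ℤ.+ + a ℤ.* + b ≡ + c ℤ.* + d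
  cast a b c d eq = ≡.trans (≡.cong (λ t → + 1 ℤ.+ t) (≡.sym (ℤ.pos-* a b)))
    (≡.trans (≡.cong +_ eq) (ℤ.pos-* c d))

divisible-or-invertible : ∀ {p} → Prime p → ∀ z → + p ∣ z ⊎ Invertible p z
divisible-or-invertible {p} p-prime z = go (z ℤ.%ℕ p) (ℤ.n%ℕd<d z p) (ℤ.a≡a%ℕn+[a/ℕn]*n z p)
  where
  instance _ = ℕ.prime⇒nonZero p-prime
  q = z ℤ./ℕ p
  cancel : ∀ r t → r ℤ.+ t ℤ.- r ≡ t
  cancel = ℤ-Solver.solve-∀
  go : ∀ r → r < p → z ≡ + r ℤ.+ q ℤ.* + p → + p ∣ z ⊎ Invertible p z
  go zero    _   z≡ = inj₁ (divides q (≡.trans z≡ (ℤ.+-identityˡ _)))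
  go (suc r) r<p z≡ = inj₂ (invertible-cong z (+ suc r)
    (divides q (≡.trans (≡.cong (ℤ._- + suc r) z≡) (cancel (+ suc r) (q ℤ.* + p))))
    (coprime⇒invertible (ℕ.prime⇒coprime p-prime r<p)))

prime∤1 : ∀ {p} → Prime p → ¬ + p ∣ + 1
prime∤1 p-prime p∣1 = ℕ.¬prime[1] (≡.subst Prime (ℕ.∣1⇒≡1 (ℤ.∣⇒∣ᵤ p∣1)) p-prime)

-- From unit values modulo each prime to a unit value modulo n

-- The property of integer polynomials that makes the residue of `f x` depend only on the residue of
-- `x`. Taking it as a hypothesis avoids a type of polynomials.
Polynomial-like : (ℤ → ℤ) → Set
Polynomial-like f = ∀ x y → x ℤ.- y ∣ f x ℤ.- f y

module _ (f : ℤ → ℤ) (f-poly : Polynomial-like f)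
         (local : ∀ {p} → Prime p → ∃[ x ] Invertible p (f x)) where

  private
    shift : ∀ {n} x y → + n ∣ x ℤ.- y → Invertible n (f y) → Invertible n (f x)
    shift x y n∣x-y = invertible-cong (f x) (f y) (ℤ.∣-trans n∣x-y (f-poly x y))

    -- The argument `x` found for `ps` changes only if `p` divides `f x`. A repeated prime never
    -- causes this, as `f x` is already invertible modulo every member of `ps`.
    go : ∀ ps → All Prime ps → ∃[ x ] Invertible (ℕ.product ps) (f x)
    go []       []             = + 0 , + 0 , divides (f (+ 0) ℤ.* + 0 ℤ.- + 1) (≡.sym (ℤ.*-identityʳ _))
    go (p ∷ ps) (p-prime ∷ primes) with go ps primes
    ... | x , inv@(w , divides d fxw-1≡dq) with divisible-or-invertible p-prime (f x)
    ...   | inj₂ inv-p = x , invertible-* p (ℕ.product ps) (f x) inv-p inv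
    ...   | inj₁ (divides c fx≡cp) with local p-prime
    ...     | y , inv-p = z , invertible-* p (ℕ.product ps) (f z)
                              (shift z y p∣z-y inv-p) (shift z x q∣z-x inv)
      where
      -- As p divides f x, which is invertible modulo q = ℕ.product ps, p and q are
      -- coprime with Bézout identity c w p - d q ≡ 1; z is congruent to x
      -- modulo q and to y modulo p.
      z : ℤ
      z = x ℤ.- d ℤ.* + ℕ.product ps ℤ.* (y ℤ.- x)
      z-y : ∀ x y e → x ℤ.- e ℤ.* (y ℤ.- x) ℤ.- y ≡ ℤ.- (e ℤ.+ + 1) ℤ.* (y ℤ.- x)
      z-y = ℤ-Solver.solve-∀
      assoc : ∀ c p w t → ℤ.- (c ℤ.* p ℤ.* w ℤ.- + 1 ℤ.+ + 1) ℤ.* t ≡ ℤ.- (c ℤ.* w ℤ.* t) ℤ.* p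
      assoc = ℤ-Solver.solve-∀
      p∣z-y : + p ∣ z ℤ.- y
      p∣z-y = divides (ℤ.- (c ℤ.* w ℤ.* (y ℤ.- x))) (≡.trans (z-y x y (d ℤ.* + ℕ.product ps))
        (≡.trans (≡.cong (λ t → ℤ.- (t ℤ.+ + 1) ℤ.* (y ℤ.- x)) (≡.sym fxw-1≡dq))
          (≡.trans (≡.cong (λ t → ℤ.- (t ℤ.* w ℤ.- + 1 ℤ.+ + 1) ℤ.* (y ℤ.- x)) fx≡cp)
            (assoc c (+ p) w (y ℤ.- x)))))
      z-x : ∀ x d q t → x ℤ.- d ℤ.* q ℤ.* t ℤ.- x ≡ ℤ.- (d ℤ.* t) ℤ.* q
      z-x = ℤ-Solver.solve-∀
      q∣z-x : + ℕ.product ps ∣ z ℤ.- x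
      q∣z-x = divides (ℤ.- (d ℤ.* (y ℤ.- x))) (z-x x d (+ ℕ.product ps) (y ℤ.- x))

  invertible-value : ∀ n .{{_ : NonZero n}} → ∃[ x ] Invertible n (f x)
  invertible-value n with factorise n
  ... | record { factors = ps ; isFactorisation = n≡ ; factorsPrime = primes } =
    ≡.subst (λ k → ∃[ x ] Invertible k (f x)) (≡.sym n≡) (go ps primes)

invertible-1+ : ∀ {n x} → + n ∣ x → Invertible n (+ 1 ℤ.+ x)
invertible-1+ {n} {x} (divides q x≡qn) = + 1 , divides q (≡.trans (eq x) x≡qn)
  where
  eq : ∀ x → (+ 1 ℤ.+ x) ℤ.* + 1 ℤ.- + 1 ≡ x
  eq = ℤ-Solver.solve-∀

-- Stable range 1 and sums of unit squares in ℤ/n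

module _ (n : ℕ) .{{_ : NonZero n}} where
  open CommutativeRing (ℤ/ n) hiding (zero)
  open UnitSquares (ℤ/ n)

  private
    unit : ∀ z → Invertible n z → Unit×
    unit z (w , n∣) = record
      { value = z ; inverse = w
      ; inverse-l = trans (*-comm w z) (congruent n∣) ; inverse-r = congruent n∣ }

  -- Modulo a prime that divides `a`, the expression is just `θ`, and `θ = 1` works; modulo any
  -- other prime `θ = 0` works.
  ℤ/-stableRange1 : StableRange1
  ℤ/-stableRange1 a b with invertible-value f poly local n
    where
    f : ℤ → ℤ
    f θ = a ℤ.+ θ ℤ.* (+ 1 ℤ.- a ℤ.* b)
    poly : Polynomial-like f
    poly x y = divides (+ 1 ℤ.- a ℤ.* b) (eq a (+ 1 ℤ.- a ℤ.* b) x y)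
      where
      eq : ∀ a c x y → a ℤ.+ x ℤ.* c ℤ.- (a ℤ.+ y ℤ.* c) ≡ c ℤ.* (x ℤ.- y)
      eq = ℤ-Solver.solve-∀
    local : ∀ {p} → Prime p → ∃[ θ ] Invertible p (f θ)
    local p-prime with divisible-or-invertible p-prime a
    ... | inj₂ inv = + 0 , ≡.subst (Invertible _) (≡.sym (ℤ.+-identityʳ a)) inv
    ... | inj₁ p∣a = + 1 , ≡.subst (Invertible _) (≡.sym (eq a b))
                             (invertible-1+ (ℤ.∣m⇒∣m*n (+ 1 ℤ.- b) p∣a))
      where
      eq : ∀ a b → a ℤ.+ + 1 ℤ.* (+ 1 ℤ.- a ℤ.* b) ≡ + 1 ℤ.+ a ℤ.* (+ 1 ℤ.- b)
      eq = ℤ-Solver.solve-∀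
  ... | θ , w , n∣ = θ , w , congruent n∣

  private
    -- The coefficients 1, -4, 6, -4, 1 are those of the fourth finite difference.
    divides-difference : ∀ {k} v₀ v₁ v₂ v₃ v₄ → k ∣ v₀ → k ∣ v₁ → k ∣ v₂ → k ∣ v₃ → k ∣ v₄ →
      k ∣ v₀ ℤ.+ v₁ ℤ.* ℤ.- + 4 ℤ.+ v₂ ℤ.* + 6 ℤ.+ v₃ ℤ.* ℤ.- + 4 ℤ.+ v₄
    divides-difference v₀ v₁ v₂ v₃ v₄ d₀ d₁ d₂ d₃ d₄ =
      ℤ.∣m∣n⇒∣m+n (ℤ.∣m∣n⇒∣m+n (ℤ.∣m∣n⇒∣m+n (ℤ.∣m∣n⇒∣m+n d₀
        (ℤ.∣m⇒∣m*n (ℤ.- + 4) d₁)) (ℤ.∣m⇒∣m*n (+ 6) d₂)) (ℤ.∣m⇒∣m*n (ℤ.- + 4) d₃)) d₄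

    module _ (b : ℤ) where
      -- `s x` is the product of the bases `6x - 1` and `6x + 1`, and `t x` that of the bases
      -- belonging to `b - x`. Hence `f x` is a unit exactly if all four bases are.
      s t f : ℤ → ℤ
      s x = (+ 6 ℤ.* x ℤ.- + 1) ℤ.* (+ 6 ℤ.* x ℤ.+ + 1)
      t x = s (b ℤ.- x)
      f x = s x ℤ.* t x

      f-poly : Polynomial-like f
      f-poly x y = divides (+ 36 ℤ.* (x ℤ.+ y) ℤ.* t x ℤ.+ s y ℤ.* (+ 36 ℤ.* (x ℤ.+ y ℤ.- + 2 ℤ.* b)))
          (≡.trans (split (s x) (s y) (t x) (t y))
        (≡.trans (≡.cong₂ (λ u v → u ℤ.* t x ℤ.+ s y ℤ.* v) (s-poly x y) (t-poly b x y))
          (assoc (x ℤ.+ y) (x ℤ.+ y ℤ.- + 2 ℤ.* b) (x ℤ.- y) (t x) (s y))))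
        where
        split : ∀ s s′ t t′ → s ℤ.* t ℤ.- s′ ℤ.* t′ ≡ (s ℤ.- s′) ℤ.* t ℤ.+ s′ ℤ.* (t ℤ.- t′)
        split = ℤ-Solver.solve-∀
        s-poly : ∀ x y → (+ 6 ℤ.* x ℤ.- + 1) ℤ.* (+ 6 ℤ.* x ℤ.+ + 1)
                         ℤ.- (+ 6 ℤ.* y ℤ.- + 1) ℤ.* (+ 6 ℤ.* y ℤ.+ + 1)
                       ≡ + 36 ℤ.* (x ℤ.+ y) ℤ.* (x ℤ.- y)
        s-poly = ℤ-Solver.solve-∀
        t-poly : ∀ b x y → (+ 6 ℤ.* (b ℤ.- x) ℤ.- + 1) ℤ.* (+ 6 ℤ.* (b ℤ.- x) ℤ.+ + 1)
                           ℤ.- (+ 6 ℤ.* (b ℤ.- y) ℤ.- + 1) ℤ.* (+ 6 ℤ.* (b ℤ.- y) ℤ.+ + 1)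
                         ≡ + 36 ℤ.* (x ℤ.+ y ℤ.- + 2 ℤ.* b) ℤ.* (x ℤ.- y)
        t-poly = ℤ-Solver.solve-∀
        assoc : ∀ u v d t s → + 36 ℤ.* u ℤ.* d ℤ.* t ℤ.+ s ℤ.* (+ 36 ℤ.* v ℤ.* d)
                            ≡ (+ 36 ℤ.* u ℤ.* t ℤ.+ s ℤ.* (+ 36 ℤ.* v)) ℤ.* d
        assoc = ℤ-Solver.solve-∀

      -- The quartic `f` has leading coefficient 6⁴, so its fourth difference is the constant 4! ·
      -- 6⁴ = 31104 for every `b`.
      fourth-difference : f (+ 0) ℤ.+ f (+ 1) ℤ.* ℤ.- + 4 ℤ.+ f (+ 2) ℤ.* + 6 ℤ.+ f (+ 3) ℤ.* ℤ.- + 4 ℤ.+ f (+ 4)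
                          ≡ + 31104
      fourth-difference = eq (+ 6) b
        where
        eq : ∀ h b →
          ((h ℤ.* + 0 ℤ.- + 1) ℤ.* (h ℤ.* + 0 ℤ.+ + 1) ℤ.*
              ((h ℤ.* (b ℤ.- + 0) ℤ.- + 1) ℤ.* (h ℤ.* (b ℤ.- + 0) ℤ.+ + 1)))
            ℤ.+ ((h ℤ.* + 1 ℤ.- + 1) ℤ.* (h ℤ.* + 1 ℤ.+ + 1) ℤ.*
                ((h ℤ.* (b ℤ.- + 1) ℤ.- + 1) ℤ.* (h ℤ.* (b ℤ.- + 1) ℤ.+ + 1))) ℤ.* ℤ.- + 4
            ℤ.+ ((h ℤ.* + 2 ℤ.- + 1) ℤ.* (h ℤ.* + 2 ℤ.+ + 1) ℤ.*
                ((h ℤ.* (b ℤ.- + 2) ℤ.- + 1) ℤ.* (h ℤ.* (b ℤ.- + 2) ℤ.+ + 1))) ℤ.* + 6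
            ℤ.+ ((h ℤ.* + 3 ℤ.- + 1) ℤ.* (h ℤ.* + 3 ℤ.+ + 1) ℤ.*
                ((h ℤ.* (b ℤ.- + 3) ℤ.- + 1) ℤ.* (h ℤ.* (b ℤ.- + 3) ℤ.+ + 1))) ℤ.* ℤ.- + 4
            ℤ.+ ((h ℤ.* + 4 ℤ.- + 1) ℤ.* (h ℤ.* + 4 ℤ.+ + 1) ℤ.*
                ((h ℤ.* (b ℤ.- + 4) ℤ.- + 1) ℤ.* (h ℤ.* (b ℤ.- + 4) ℤ.+ + 1)))
          ≡ + 24 ℤ.* (h ℤ.* h ℤ.* (h ℤ.* h))
        eq = ℤ-Solver.solve-∀

      -- With c = 36 b² we have f 0 = 1 - c and c⁴ = 31104 · 54 b⁸.
      f-coprime : ∀ {p} → + p ∣ f (+ 0) → + p ∣ + 31104 → + p ∣ + 1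
      f-coprime {p} p∣f0 p∣31104 = ≡.subst (+ p ∣_)
        (≡.trans (≡.cong₂ ℤ._+_ (≡.cong (ℤ._* cofactor) (f0 b)) (power (b ℤ.* b))) (telescope (+ 36 ℤ.* (b ℤ.* b))))
        (ℤ.∣m∣n⇒∣m+n (ℤ.∣m⇒∣m*n cofactor p∣f0) (ℤ.∣m⇒∣m*n
            (+ 54 ℤ.* ((b ℤ.* b) ℤ.* (b ℤ.* b) ℤ.* ((b ℤ.* b) ℤ.* (b ℤ.* b)))) p∣31104))
        where
        cofactor = (+ 1 ℤ.+ + 36 ℤ.* (b ℤ.* b)) ℤ.* (+ 1 ℤ.+ + 36 ℤ.* (b ℤ.* b) ℤ.* (+ 36 ℤ.* (b ℤ.* b)))
        f0 : ∀ b → ℤ.- + 1 ℤ.* ((+ 6 ℤ.* (b ℤ.- + 0) ℤ.- + 1) ℤ.* (+ 6 ℤ.* (b ℤ.- + 0) ℤ.+ + 1))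
                 ≡ + 1 ℤ.- + 36 ℤ.* (b ℤ.* b)
        f0 = ℤ-Solver.solve-∀
        power : ∀ u → + 31104 ℤ.* (+ 54 ℤ.* (u ℤ.* u ℤ.* (u ℤ.* u)))
              ≡ + 36 ℤ.* u ℤ.* (+ 36 ℤ.* u) ℤ.* (+ 36 ℤ.* u ℤ.* (+ 36 ℤ.* u))
        power u = ≡.trans (≡.sym (ℤ.*-assoc (+ 31104) (+ 54) (u ℤ.* u ℤ.* (u ℤ.* u)))) (≡.sym (fourth (+ 36) u))
          where
          fourth : ∀ k u → k ℤ.* u ℤ.* (k ℤ.* u) ℤ.* (k ℤ.* u ℤ.* (k ℤ.* u))
                         ≡ k ℤ.* k ℤ.* (k ℤ.* k) ℤ.* (u ℤ.* u ℤ.* (u ℤ.* u))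
          fourth = ℤ-Solver.solve-∀
        telescope : ∀ c → (+ 1 ℤ.- c) ℤ.* ((+ 1 ℤ.+ c) ℤ.* (+ 1 ℤ.+ c ℤ.* c)) ℤ.+ c ℤ.* c ℤ.* (c ℤ.* c) ≡ + 1
        telescope = ℤ-Solver.solve-∀

      -- A prime dividing all of `f 0`, ..., `f 4` divides their fourth difference 31104, so it is 2
      -- or 3; but `f 0 = 1 - 36 b²` is prime to 6. This handles small and large primes at once,
      -- without counting roots.
      f-local : ∀ {p} → Prime p → ∃[ x ] Invertible p (f x)
      f-local {p} p-prime = go (dichotomy (+ 0)) (dichotomy (+ 1)) (dichotomy (+ 2)) (dichotomy (+ 3))
          (dichotomy (+ 4))
        where
        Dichotomy : ℤ → Set
        Dichotomy x = + p ∣ f x ⊎ Invertible p (f x)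
        dichotomy : ∀ x → Dichotomy x
        dichotomy x = divisible-or-invertible p-prime (f x)
        go : Dichotomy (+ 0) → Dichotomy (+ 1) → Dichotomy (+ 2) → Dichotomy (+ 3) → Dichotomy (+ 4) →
             ∃[ x ] Invertible p (f x)
        go (inj₂ i) _ _ _ _ = + 0 , i
        go _ (inj₂ i) _ _ _ = + 1 , i
        go _ _ (inj₂ i) _ _ = + 2 , i
        go _ _ _ (inj₂ i) _ = + 3 , i
        go _ _ _ _ (inj₂ i) = + 4 , i
        go (inj₁ d₀) (inj₁ d₁) (inj₁ d₂) (inj₁ d₃) (inj₁ d₄) = contradiction
          (f-coprime d₀ (≡.subst (+ p ∣_) fourth-difference
            (divides-difference (f (+ 0)) (f (+ 1)) (f (+ 2)) (f (+ 3)) (f (+ 4)) d₀ d₁ d₂ d₃ d₄)))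
          (prime∤1 p-prime)

    natural : ∀ {N} r → r ≤ N → UnitSquareSum N (+ r)
    natural         zero    _       = none refl
    natural {suc N} (suc r) (ℕ.s≤s r≤N) =
      plus (record { value = + 1 ; inverse = + 1 ; inverse-l = refl ; inverse-r = refl }) refl (natural r r≤N)

  -- 27 = 4 + 23: four squares for the multiple of 24, and at most 23 copies of 1² for the
  -- remainder.
  ℤ/-unitSquareSum : ∀ a → UnitSquareSum 27 a
  ℤ/-unitSquareSum a = go (a ℤ.%ℕ 24) (ℤ.n%ℕd<d a 24) (ℤ.a≡a%ℕn+[a/ℕn]*n a 24)
    where
    b = a ℤ./ℕ 24
    expand : ∀ r b x → r ℤ.+ b ℤ.* + 24 ≡
      (+ 6 ℤ.* x ℤ.+ + 1) ℤ.* (+ 6 ℤ.* x ℤ.+ + 1) ℤ.+ (ℤ.- ((+ 6 ℤ.* x ℤ.- + 1) ℤ.* (+ 6 ℤ.* x ℤ.- + 1)) ℤ.+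
      ((+ 6 ℤ.* (b ℤ.- x) ℤ.+ + 1) ℤ.* (+ 6 ℤ.* (b ℤ.- x) ℤ.+ + 1) ℤ.+
      (ℤ.- ((+ 6 ℤ.* (b ℤ.- x) ℤ.- + 1) ℤ.* (+ 6 ℤ.* (b ℤ.- x) ℤ.- + 1)) ℤ.+ r)))
    expand = ℤ-Solver.solve-∀
    go : ∀ r → r ℕ.< 24 → a ≡ + r ℤ.+ b ℤ.* + 24 → UnitSquareSum 27 a
    go r (ℕ.s≤s r≤23) a≡ = choose (invertible-value (f b) (f-poly b) (f-local b) n)
      where
      factors : ∀ x → Invertible n (s b x) → Invertible n (+ 6 ℤ.* x ℤ.- + 1) × Invertible n (+ 6 ℤ.* x ℤ.+ + 1)
      factors x inv = invertible-factorˡ (+ 6 ℤ.* x ℤ.- + 1) (+ 6 ℤ.* x ℤ.+ + 1) inv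
                    , invertible-factorʳ (+ 6 ℤ.* x ℤ.- + 1) (+ 6 ℤ.* x ℤ.+ + 1) inv
      sum : ∀ x → Invertible n (+ 6 ℤ.* x ℤ.- + 1) × Invertible n (+ 6 ℤ.* x ℤ.+ + 1) →
            Invertible n (+ 6 ℤ.* (b ℤ.- x) ℤ.- + 1) × Invertible n (+ 6 ℤ.* (b ℤ.- x) ℤ.+ + 1) →
            UnitSquareSum 27 a
      sum x (i₁ , i₂) (i₃ , i₄) =
        plus (unit (+ 6 ℤ.* x ℤ.+ + 1) i₂) (reflexive (≡.trans a≡ (expand (+ r) b x)))
          (minus (unit (+ 6 ℤ.* x ℤ.- + 1) i₁) refl (plus (unit (+ 6 ℤ.* (b ℤ.- x) ℤ.+ + 1) i₄) refl
              (minus (unit (+ 6 ℤ.* (b ℤ.- x) ℤ.- + 1) i₃) refl (natural r r≤23))))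
      choose : ∃[ x ] Invertible n (f b x) → UnitSquareSum 27 a
      choose (x , inv) = sum x (factors x (invertible-factorˡ (s b x) (t b x) inv))
                               (factors (b ℤ.- x) (invertible-factorʳ (s b x) (t b x) inv))

-- The symplectic form on column vectors

module SymplecticForm {c ℓ} (R : CommutativeRing c ℓ) (m : ℕ) where
  open CommutativeRing R hiding (zero)
  open RingProperties ring
  open SemiringSum semiring
    using (sum; sum-cong-≋; *-distribˡ-sum; *-distribʳ-sum; ∑-comm; ∑-distrib-+)
  open Symplectic R m
  open IntegerSolver R
  open SetoidReasoning setoid

  Vec : Set c
  Vec = Index → Carrier

  δ-≡ : ∀ {k} {i j : Fin k} → i ≡ j → δ i j ≈ 1#
  δ-≡ {i = i} {j} i≡j = reflexive (≡.cong (if_then 1# else 0#) (dec-true (i ≟ j) i≡j))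

  δ-≢ : ∀ {k} {i j : Fin k} → i ≢ j → δ i j ≈ 0#
  δ-≢ {i = i} {j} i≢j = reflexive (≡.cong (if_then 1# else 0#) (dec-false (i ≟ j) i≢j))

  δ-⇔ : ∀ {k l} (i j : Fin k) (i′ j′ : Fin l) → (i ≡ j → i′ ≡ j′) → (i′ ≡ j′ → i ≡ j) → δ i j ≈ δ i′ j′
  δ-⇔ i j i′ j′ to from with i ≟ j
  ... | yes i≡j = sym (δ-≡ (to i≡j))
  ... | no  i≢j = sym (δ-≢ (i≢j ∘ from))

  δ-sym : ∀ {k} (i j : Fin k) → δ i j ≈ δ j i
  δ-sym i j = δ-⇔ i j j i ≡.sym ≡.sym

  *δ-subst : ∀ (f : Vec) i j → f i * δ i j ≈ f j * δ i j
  *δ-subst f i j with i ≟ j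
  ... | yes ≡.refl = refl
  ... | no  _      = trans (zeroʳ _) (sym (zeroʳ _))

  sum-*δ : ∀ (f : Vec) j → sum (λ i → f i * δ i j) ≈ f j
  -- The sum is an entry of `A · 𝟙`, where every row of `A` is `f`.
  sum-*δ f j = ·-identityʳ (λ _ → f) j j

  +m-≢ : ∀ j → j +m ≢ j
  +m-≢ j eq with splitAt m j in split
  ... | inj₁ a with () ← ≡.trans (≡.sym split) (≡.trans (≡.cong (splitAt m) (≡.sym eq)) (splitAt-↑ʳ m m a))
  ... | inj₂ a with () ← ≡.trans (≡.sym split) (≡.trans (≡.cong (splitAt m) (≡.sym eq)) (splitAt-↑ˡ m a m))

  δ-+m : ∀ i j → δ (i +m) j ≈ δ i (j +m)
  δ-+m i j = δ-⇔ (i +m) j i (j +m) (λ eq → ≡.trans (≡.sym (+m-involutive i)) (≡.cong _+m eq))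
                 (λ eq → ≡.trans (≡.cong _+m eq) (+m-involutive j))

  -- `σ` is a signed permutation matrix: row `i` vanishes off column `i +m`, where its entry is the
  -- sign `τ i`. Formulas in `τ` treat both halves of the index set alike.
  τ : Index → Carrier
  τ i with splitAt m i
  ... | inj₁ _ = - 1#
  ... | inj₂ _ = 1#

  τ-+m : ∀ i → τ (i +m) ≈ - τ i
  τ-+m i with splitAt m i
  ... | inj₁ a rewrite splitAt-↑ʳ m m a = sym (-‿involutive 1#)
  ... | inj₂ a rewrite splitAt-↑ˡ m a m = refl

  τ*τ : ∀ i → τ i * τ i ≈ 1#
  τ*τ i with splitAt m i
  ... | inj₁ _ = solve 0 (:- con (+ 1) :* :- con (+ 1) := con (+ 1)) refl
  ... | inj₂ _ = *-identityˡ 1#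

  τ*-cancel : ∀ i x y → τ i * x ≈ τ i * y → x ≈ y
  τ*-cancel i x y eq = begin
    x               ≈⟨ absorb x ⟨
    τ i * (τ i * x) ≈⟨ *-congˡ eq ⟩
    τ i * (τ i * y) ≈⟨ absorb y ⟩
    y               ∎
    where
    absorb : ∀ z → τ i * (τ i * z) ≈ z
    absorb z = trans (sym (*-assoc _ _ _)) (trans (*-congʳ (τ*τ i)) (*-identityˡ z))

  σ-τ : ∀ i j → σ i j ≈ τ i * δ (i +m) j
  σ-τ i j with splitAt m i | splitAt m j in eq
  ... | inj₁ a | inj₁ b = sym (trans (*-congˡ (δ-≢ λ r → case r)) (zeroʳ _))
    where
    case : m ↑ʳ a ≢ j
    case r with () ← ≡.trans (≡.sym (splitAt-↑ʳ m m a)) (≡.trans (≡.cong (splitAt m) r) eq)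
  ... | inj₁ a | inj₂ b = begin
    - δ a b                ≈⟨ -1*x≈-x _ ⟨
    - 1# * δ a b           ≈⟨ *-congˡ (δ-⇔ a b (m ↑ʳ a) j (λ r → ≡.trans (≡.cong (m ↑ʳ_) r) j≡)
                                           (λ r → ↑ʳ-injective m a b (≡.trans r (≡.sym j≡)))) ⟩
    - 1# * δ (m ↑ʳ a) j    ∎
    where
    j≡ : m ↑ʳ b ≡ j
    j≡ = ≡.trans (≡.cong (join m m) (≡.sym eq)) (join-splitAt m m j)
  ... | inj₂ a | inj₁ b = sym (trans (*-identityˡ _) (sym
      (δ-⇔ a b (a ↑ˡ m) j (λ r → ≡.trans (≡.cong (_↑ˡ m) r) j≡)
           (λ r → ↑ˡ-injective m a b (≡.trans r (≡.sym j≡))))))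
    where
    j≡ : b ↑ˡ m ≡ j
    j≡ = ≡.trans (≡.cong (join m m) (≡.sym eq)) (join-splitAt m m j)
  ... | inj₂ a | inj₂ b = sym (trans (*-congˡ (δ-≢ λ r → case r)) (zeroʳ _))
    where
    case : a ↑ˡ m ≢ j
    case r with () ← ≡.trans (≡.sym (splitAt-↑ˡ m a m)) (≡.trans (≡.cong (splitAt m) r) eq)

  -- (S ᵀ · σ · S) i j is ω applied to the columns i and j of S.
  ω : Vec → Vec → Carrier
  ω v w = sum λ t → (sum λ s → v s * σ s t) * w t

  ω-sum : ∀ v w → ω v w ≈ sum λ s → v s * (τ s * w (s +m))
  ω-sum v w = begin
    sum (λ t → sum (λ s → v s * σ s t) * w t)
      ≈⟨ sum-cong-≋ (λ t → *-distribʳ-sum (w t) (λ s → v s * σ s t)) ⟩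
    sum (λ t → sum (λ s → v s * σ s t * w t))
      ≈⟨ ∑-comm (λ t s → v s * σ s t * w t) ⟩
    sum (λ s → sum (λ t → v s * σ s t * w t))
      ≈⟨ sum-cong-≋ (λ s → sum-cong-≋ λ t → term s t) ⟩
    sum (λ s → sum (λ t → (v s * τ s) * (w t * δ t (s +m))))
      ≈⟨ sum-cong-≋ (λ s → *-distribˡ-sum (v s * τ s) (λ t → w t * δ t (s +m))) ⟨
    sum (λ s → (v s * τ s) * sum (λ t → w t * δ t (s +m)))
      ≈⟨ sum-cong-≋ (λ s → trans (*-congˡ (sum-*δ w (s +m))) (*-assoc _ _ _)) ⟩
    sum (λ s → v s * (τ s * w (s +m)))
      ∎
    where
    term : ∀ s t → v s * σ s t * w t ≈ (v s * τ s) * (w t * δ t (s +m))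
    term s t = trans (*-congʳ (*-congˡ (trans (σ-τ s t) (*-congˡ (δ-sym (s +m) t)))))
      (solve 4 (λ v τ w d → v :* (τ :* d) :* w := (v :* τ) :* (w :* d)) refl (v s) (τ s) (w t) (δ t (s +m)))

  ω-cong : ∀ {v v′ w w′} → (∀ i → v i ≈ v′ i) → (∀ i → w i ≈ w′ i) → ω v w ≈ ω v′ w′
  ω-cong v≈v′ w≈w′ = sum-cong-≋ λ t → *-cong (sum-cong-≋ λ s → *-congʳ (v≈v′ s)) (w≈w′ t)

  private
    term : Vec → Vec → Vec
    term v w s = v s * (τ s * w (s +m))

    sum-linear : ∀ (f : Vec) a (g : Vec) → sum (λ s → f s + a * g s) ≈ sum f + a * sum g
    sum-linear f a g = trans (∑-distrib-+ f (λ s → a * g s)) (+-congˡ (sym (*-distribˡ-sum a g)))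

  ω-linearˡ : ∀ u a v w → ω (λ i → u i + a * v i) w ≈ ω u w + a * ω v w
  ω-linearˡ u a v w = begin
    ω (λ i → u i + a * v i) w
      ≈⟨ ω-sum _ w ⟩
    sum (term (λ i → u i + a * v i) w)
      ≈⟨ sum-cong-≋ {m ℕ.+ m} (λ s → trans (distribʳ _ _ _) (+-congˡ (*-assoc _ _ _))) ⟩
    sum (λ s → term u w s + a * term v w s)
      ≈⟨ sum-linear (term u w) a (term v w) ⟩
    sum (term u w) + a * sum (term v w)
      ≈⟨ +-cong (ω-sum u w) (*-congˡ (ω-sum v w)) ⟨
    ω u w + a * ω v w
      ∎

  ω-linearʳ : ∀ u v a w → ω u (λ i → v i + a * w i) ≈ ω u v + a * ω u w
  ω-linearʳ u v a w = begin
    ω u (λ i → v i + a * w i)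
      ≈⟨ ω-sum u _ ⟩
    sum (term u (λ i → v i + a * w i))
      ≈⟨ sum-cong-≋ {m ℕ.+ m} (λ s → solve 5 (λ u τ v a w → u :* (τ :* (v :+ a :* w)) := u :* (τ :* v) :+ a :*
          (u :* (τ :* w)))
                       refl (u s) (τ s) (v (s +m)) a (w (s +m))) ⟩
    sum (λ s → term u v s + a * term u w s)
      ≈⟨ sum-linear (term u v) a (term u w) ⟩
    sum (term u v) + a * sum (term u w)
      ≈⟨ +-cong (ω-sum u v) (*-congˡ (ω-sum u w)) ⟨
    ω u v + a * ω u w
      ∎

  ω-*ˡ : ∀ a v w → ω (λ i → a * v i) w ≈ a * ω v w
  ω-*ˡ a v w = begin
    ω (λ i → a * v i) w           ≈⟨ ω-sum _ w ⟩
    sum (term (λ i → a * v i) w)  ≈⟨ sum-cong-≋ {m ℕ.+ m} (λ s → *-assoc _ _ _) ⟩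
    sum (λ s → a * term v w s)    ≈⟨ *-distribˡ-sum a (term v w) ⟨
    a * sum (term v w)            ≈⟨ *-congˡ (ω-sum v w) ⟨
    a * ω v w                     ∎

  σ-antisym : ∀ s t → σ s t ≈ - 1# * σ t s
  σ-antisym s t = begin
    σ s t                       ≈⟨ σ-τ s t ⟩
    τ s * δ (s +m) t            ≈⟨ *-congˡ (δ-+m s t) ⟩
    τ s * δ s (t +m)            ≈⟨ *δ-subst τ s (t +m) ⟩
    τ (t +m) * δ s (t +m)       ≈⟨ *-cong (τ-+m t) (δ-sym s (t +m)) ⟩
    - τ t * δ (t +m) s          ≈⟨ -‿distribˡ-* _ _ ⟨
    - (τ t * δ (t +m) s)        ≈⟨ -1*x≈-x _ ⟨
    - 1# * (τ t * δ (t +m) s)   ≈⟨ *-congˡ (σ-τ t s) ⟨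
    - 1# * σ t s                ∎

  ω-antisym : ∀ v w → ω v w ≈ - ω w v
  ω-antisym v w = begin
    sum (λ t → sum (λ s → v s * σ s t) * w t)
      ≈⟨ sum-cong-≋ (λ t → *-distribʳ-sum (w t) (λ s → v s * σ s t)) ⟩
    sum (λ t → sum (λ s → v s * σ s t * w t))
      ≈⟨ ∑-comm (λ t s → v s * σ s t * w t) ⟩
    sum (λ s → sum (λ t → v s * σ s t * w t))
      ≈⟨ sum-cong-≋ (λ s → sum-cong-≋ λ t → trans (*-congʳ (*-congˡ (σ-antisym s t)))
           (solve 3 (λ v q w → v :* (:- con (+ 1) :* q) :* w := (w :* q) :* (:- con (+ 1) :* v)) refl (v s)
               (σ t s) (w t))) ⟩
    sum (λ s → sum (λ t → w t * σ t s * (- 1# * v s)))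
      ≈⟨ sum-cong-≋ (λ s → *-distribʳ-sum (- 1# * v s) (λ t → w t * σ t s)) ⟨
    sum (λ s → sum (λ t → w t * σ t s) * (- 1# * v s))
      ≈⟨ sum-cong-≋ (λ s → solve 2 (λ x y → x :* (:- con (+ 1) :* y) := :- con (+ 1) :* (x :* y)) refl
          (sum (λ t → w t * σ t s)) (v s)) ⟩
    sum (λ s → - 1# * (sum (λ t → w t * σ t s) * v s))
      ≈⟨ *-distribˡ-sum (- 1#) (λ s → sum (λ t → w t * σ t s) * v s) ⟨
    - 1# * ω w v
      ≈⟨ -1*x≈-x _ ⟩
    - ω w v
      ∎

  basis : Index → Vec
  basis j i = δ i j

  ω-basisˡ : ∀ j w → ω (basis j) w ≈ τ j * w (j +m)
  ω-basisˡ j w = trans (ω-sum (basis j) w)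
    (trans (sum-cong-≋ (λ s → *-comm (δ s j) (τ s * w (s +m)))) (sum-*δ (λ s → τ s * w (s +m)) j))

  ω-basisʳ : ∀ v j → ω v (basis j) ≈ - τ j * v (j +m)
  ω-basisʳ v j = begin
    ω v (basis j)                             ≈⟨ ω-sum v (basis j) ⟩
    sum (λ s → v s * (τ s * δ (s +m) j))      ≈⟨ sum-cong-≋
        (λ s → trans (*-congˡ (*-congˡ (δ-+m s j))) (sym (*-assoc _ _ _))) ⟩
    sum (λ s → (v s * τ s) * δ s (j +m))      ≈⟨ sum-*δ (λ s → v s * τ s) (j +m) ⟩
    v (j +m) * τ (j +m)                       ≈⟨ *-comm _ _ ⟩
    τ (j +m) * v (j +m)                       ≈⟨ *-congʳ (τ-+m j) ⟩
    - τ j * v (j +m)                          ∎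

  IsIsometry : (Vec → Vec) → Set (c ⊔ ℓ)
  IsIsometry F = ∀ v w → ω (F v) (F w) ≈ ω v w

  onColumns : (Vec → Vec) → Matrix → Matrix
  onColumns F A i l = F (λ t → A t l) i

  isometry-symplectic : ∀ {F A} → IsIsometry F → IsSymplectic A → IsSymplectic (onColumns F A)
  isometry-symplectic iso symp i j = trans (iso _ _) (symp i j)

  𝟙-symplectic : IsSymplectic 𝟙
  𝟙-symplectic i j = trans (ω-basisˡ i (basis j)) (sym (σ-τ i j))

  symplectic-cong : ∀ {A B} → A ≋ B → IsSymplectic A → IsSymplectic B
  symplectic-cong A≋B symp i j = trans (sym (ω-cong (λ t → A≋B t i) (λ t → A≋B t j))) (symp i j)

-- Unipotents of Heisenberg type

module Transvections {c ℓ} (R : CommutativeRing c ℓ) (m : ℕ) where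
  open CommutativeRing R hiding (zero)
  open RingProperties ring
  open SemiringSum semiring
    using (sum; sum-cong-≋)
  open Symplectic R m
  open SymplecticForm R m
  open UnitSquares R
  open IntegerSolver R
  open SetoidReasoning setoid

  -- Applied to t vanishing at p and p + m.  Then C p k acts as T p e_k 0, or as
  -- T p 0 1 when k = p + m.
  T : Index → Vec → Carrier → Vec → Vec
  T p t c v i = (v i + v p * t i) + (c * v p - τ p * ω t v) * basis (p +m) i

  0ᵥ : Vec
  0ᵥ _ = 0#

  infixr 7 _*ᵥ_
  _*ᵥ_ : Carrier → Vec → Vec
  (a *ᵥ v) i = a * v i

  record OffPair (p : Index) (t : Vec) : Set ℓ where
    constructor offPair
    field
      at-p  : t p ≈ 0#
      at-p′ : t (p +m) ≈ 0#
  open OffPair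

  T-cong : ∀ p {t t′ c c′ v v′} → (∀ i → t i ≈ t′ i) → c ≈ c′ → (∀ i → v i ≈ v′ i) →
           ∀ i → T p t c v i ≈ T p t′ c′ v′ i
  T-cong p t≈t′ c≈c′ v≈v′ i =
    +-cong (+-cong (v≈v′ i) (*-cong (v≈v′ p) (t≈t′ i)))
           (*-congʳ (+-cong (*-cong c≈c′ (v≈v′ p)) (-‿cong (*-congˡ (ω-cong t≈t′ v≈v′)))))

  ω-0ˡ : ∀ {t} v → (∀ i → t i ≈ 0#) → ω t v ≈ 0#
  ω-0ˡ {t} v t≈0 = trans (ω-cong (λ i → trans (t≈0 i) (sym (zeroˡ (t i)))) (λ i → refl))
    (trans (ω-*ˡ 0# t v) (zeroˡ _))

  T-identity : ∀ p {t c} v → (∀ i → t i ≈ 0#) → c ≈ 0# → ∀ i → T p t c v i ≈ v i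
  T-identity p {t} {c} v t≈0 c≈0 i = begin
    T p t c v i
      ≈⟨ +-cong (+-congˡ (*-congˡ (t≈0 i))) (*-congʳ (+-cong (*-congʳ c≈0) (-‿cong (*-congˡ (ω-0ˡ v t≈0))))) ⟩
    (v i + v p * 0#) + (0# * v p - τ p * 0#) * basis (p +m) i
      ≈⟨ solve 4 (λ x y τ b → (x :+ y :* con (+ 0)) :+ (con (+ 0) :* y :- τ :* con (+ 0)) :* b := x)
               refl (v i) (v p) (τ p) (basis (p +m) i) ⟩
    v i ∎

  T-pivot : ∀ p {t} → OffPair p t → ∀ c v → T p t c v p ≈ v p
  T-pivot p {t} off c v = begin
    (v p + v p * t p) + (c * v p - τ p * ω t v) * δ p (p +m)
      ≈⟨ +-cong (+-congˡ (*-congˡ (at-p off))) (*-congˡ (δ-≢ (+m-≢ p ∘ ≡.sym))) ⟩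
    (v p + v p * 0#) + (c * v p - τ p * ω t v) * 0#
      ≈⟨ solve 2 (λ x y → (x :+ x :* con (+ 0)) :+ y :* con (+ 0) := x) refl (v p) (c * v p - τ p * ω t v) ⟩
    v p ∎

  ω-pivotʳ : ∀ p {t} → OffPair p t → ω t (basis (p +m)) ≈ 0#
  ω-pivotʳ p {t} off = trans (ω-basisʳ t (p +m))
    (trans (*-congˡ (trans (reflexive (≡.cong t (+m-involutive p))) (at-p off))) (zeroʳ _))

  -- The Heisenberg group law: `t` is additive, and the central coordinate `c` picks up the cocycle
  -- `- τ p * ω t t′`.
  T-∘ : ∀ p {t t′} → OffPair p t → OffPair p t′ → ∀ c c′ v i →
        T p t c (T p t′ c′ v) i ≈ T p (λ j → t j + t′ j) (c + c′ - τ p * ω t t′) v i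
  T-∘ p {t} {t′} off off′ c c′ v i = begin
    (v′ i + v′ p * t i) + (c * v′ p - τ p * ω t v′) * b
      ≈⟨ +-cong (+-congˡ (*-congʳ pivot)) (*-congʳ (+-cong (*-congˡ pivot) (-‿cong (*-congˡ form)))) ⟩
    (v′ i + v p * t i) + (c * v p - τ p * (ω t v + v p * ω t t′)) * b
      ≈⟨ solve 11 (λ x y s s′ c c′ τ o o′ q b →
           (((x :+ y :* s′) :+ (c′ :* y :- τ :* o′) :* b) :+ y :* s) :+ (c :* y :- τ :* (o :+ y :* q)) :* b
           := (x :+ y :* (s :+ s′)) :+ ((c :+ c′ :- τ :* q) :* y :- τ :* (o :+ o′)) :* b)
         refl (v i) (v p) (t i) (t′ i) c c′ (τ p) (ω t v) (ω t′ v) (ω t t′) b ⟩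
    (v i + v p * (t i + t′ i)) + ((c + c′ - τ p * ω t t′) * v p - τ p * (ω t v + ω t′ v)) * b
      ≈⟨ +-congˡ (*-congʳ (+-congˡ (-‿cong (*-congˡ additive)))) ⟨
    T p (λ j → t j + t′ j) (c + c′ - τ p * ω t t′) v i
      ∎
    where
    v′ = T p t′ c′ v
    b  = basis (p +m) i
    pivot : v′ p ≈ v p
    pivot = T-pivot p off′ c′ v
    form : ω t v′ ≈ ω t v + v p * ω t t′
    form = begin
      ω t v′
        ≈⟨ ω-linearʳ t (λ j → v j + v p * t′ j) (c′ * v p - τ p * ω t′ v) (basis (p +m)) ⟩
      ω t (λ j → v j + v p * t′ j) + (c′ * v p - τ p * ω t′ v) * ω t (basis (p +m))
        ≈⟨ +-cong (ω-linearʳ t v (v p) t′) (trans (*-congˡ (ω-pivotʳ p off)) (zeroʳ _)) ⟩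
      (ω t v + v p * ω t t′) + 0#
        ≈⟨ +-identityʳ _ ⟩
      ω t v + v p * ω t t′
        ∎
    additive : ω (λ j → t j + t′ j) v ≈ ω t v + ω t′ v
    additive = begin
      ω (λ j → t j + t′ j) v        ≈⟨ ω-cong (λ j → +-congˡ (*-identityˡ (t′ j))) (λ j → refl) ⟨
      ω (λ j → t j + 1# * t′ j) v   ≈⟨ ω-linearˡ t 1# t′ v ⟩
      ω t v + 1# * ω t′ v           ≈⟨ +-congˡ (*-identityˡ _) ⟩
      ω t v + ω t′ v                ∎

  -- `basis b` has coordinate zero at `p`, and it pairs with `t` only through `t (b +m)`. This is
  -- what protects columns that are already reduced.
  T-fixes : ∀ p b {t} → b ≢ p → t (b +m) ≈ 0# → ∀ c i → T p t c (basis b) i ≈ basis b i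
  T-fixes p b {t} b≢p tb≈0 c i = begin
    (δ i b + δ p b * t i) + (c * δ p b - τ p * ω t (basis b)) * δ i (p +m)
      ≈⟨ +-cong (+-congˡ (*-congʳ (δ-≢ (b≢p ∘ ≡.sym))))
                (*-congʳ (+-cong (*-congˡ (δ-≢ (b≢p ∘ ≡.sym)))
                    (-‿cong (*-congˡ (trans (ω-basisʳ t b) (*-congˡ tb≈0)))))) ⟩
    (δ i b + 0# * t i) + (c * 0# - τ p * (- τ b * 0#)) * δ i (p +m)
      ≈⟨ solve 6 (λ x s c τ τ′ d → (x :+ con (+ 0) :* s) :+ (c :* con (+ 0) :- τ :* (:- τ′ :* con (+ 0))) :* d := x)
               refl (δ i b) (t i) c (τ p) (τ b) (δ i (p +m)) ⟩
    δ i b ∎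

  -- Bilinear expansion leaves a multiple of `1# - τ p * τ p` as the discrepancy. Antisymmetry only
  -- shows that twice `ω t t` vanishes, and 2 may be a zero divisor, so `ω t t ≈ 0#` is a
  -- hypothesis. It is checked for elementary `t`; a general `T p t c` inherits the isometry
  -- property from its factors.
  T-isometry : ∀ p {t} → OffPair p t → ω t t ≈ 0# → ∀ c → IsIsometry (T p t c)
  T-isometry p {t} off iso c v w = begin
    ω (T p t c v) (T p t c w)
      ≈⟨ ω-linearˡ _ γv e w′ ⟩
    ω (λ i → v i + v p * t i) w′ + γv * ω e w′
      ≈⟨ +-cong (ω-linearˡ v (v p) t w′) (*-congˡ (expand e)) ⟩
    (ω v w′ + v p * ω t w′) + γv * ((ω e w + w p * ω e t) + γw * ω e e)
      ≈⟨ +-congʳ (+-cong (expand v) (*-congˡ (expand t))) ⟩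
    (((ω v w + w p * ω v t) + γw * ω v e) + v p * ((ω t w + w p * ω t t) + γw * ω t e))
      + γv * ((ω e w + w p * ω e t) + γw * ω e e)
      ≈⟨ +-cong (+-cong (+-cong (+-congˡ (*-congˡ (ω-antisym v t))) (*-congˡ ve))
                        (*-congˡ (+-cong (+-congˡ (*-congˡ iso)) (*-congˡ te))))
                (*-congˡ (+-cong (+-cong (ew w) (*-congˡ et)) (*-congˡ ee))) ⟩
    (((ω v w + w p * - ω t v) + γw * (τ p * v p)) + v p * ((ω t w + w p * 0#) + γw * 0#))
      + γv * ((- (τ p * w p) + w p * 0#) + γw * 0#)
      ≈⟨ solve 7 (λ o x y a b c τ →
           (((o :+ y :* :- a) :+ (c :* y :- τ :* b) :* (τ :* x)) :+ x :*
               ((b :+ y :* con (+ 0)) :+ (c :* y :- τ :* b) :* con (+ 0)))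
             :+ (c :* x :- τ :* a) :* ((:- (τ :* y) :+ y :* con (+ 0)) :+ (c :* y :- τ :* b) :* con (+ 0))
           := o :+ (con (+ 1) :- τ :* τ) :* (x :* b :- y :* a))
         refl (ω v w) (v p) (w p) (ω t v) (ω t w) c (τ p) ⟩
    ω v w + (1# - τ p * τ p) * (v p * ω t w - w p * ω t v)
      ≈⟨ +-congˡ (trans (*-congʳ (trans (+-congˡ (-‿cong (τ*τ p))) (-‿inverseʳ 1#))) (zeroˡ _)) ⟩
    ω v w + 0#
      ≈⟨ +-identityʳ _ ⟩
    ω v w
      ∎
    where
    e = basis (p +m)
    γv = c * v p - τ p * ω t v
    γw = c * w p - τ p * ω t w
    w′ = T p t c w
    expand : ∀ u → ω u w′ ≈ (ω u w + w p * ω u t) + γw * ω u e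
    expand u = trans (ω-linearʳ u (λ i → w i + w p * t i) γw e) (+-congʳ (ω-linearʳ u w (w p) t))
    ve : ω v e ≈ τ p * v p
    ve = trans (ω-basisʳ v (p +m)) (*-cong (trans (-‿cong (τ-+m p)) (-‿involutive _))
        (reflexive (≡.cong v (+m-involutive p))))
    te : ω t e ≈ 0#
    te = ω-pivotʳ p off
    ew : ∀ u → ω e u ≈ - (τ p * u p)
    ew u = trans (ω-basisˡ (p +m) u) (trans (*-cong (τ-+m p) (reflexive (≡.cong u (+m-involutive p))))
        (sym (-‿distribˡ-* _ _)))
    et : ω e t ≈ 0#
    et = trans (ew t) (trans (-‿cong (trans (*-congˡ (at-p off)) (zeroʳ _))) -0#≈0#)
    ee : ω e e ≈ 0#
    ee = trans (ew e) (trans (-‿cong (trans (*-congˡ (δ-≢ (+m-≢ p ∘ ≡.sym))) (zeroʳ _))) -0#≈0#)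

  basis-offPair : ∀ {p j} → p ≢ j → p ≢ j +m → ∀ a → OffPair p (a *ᵥ basis j)
  basis-offPair {p} {j} p≢j p≢j′ a = offPair
    (trans (*-congˡ (δ-≢ p≢j)) (zeroʳ a))
    (trans (*-congˡ (δ-≢ λ eq → p≢j′ (≡.trans (≡.sym (+m-involutive p)) (≡.cong _+m eq)))) (zeroʳ a))

  ω-*basisˡ : ∀ a j v → ω (a *ᵥ basis j) v ≈ a * (τ j * v (j +m))
  ω-*basisˡ a j v = trans (ω-*ˡ a (basis j) v) (*-congˡ (ω-basisˡ j v))

  T-basis-isometry : ∀ {p j} → p ≢ j → p ≢ j +m → ∀ a → IsIsometry (T p (a *ᵥ basis j) 0#)
  T-basis-isometry {p} {j} p≢j p≢j′ a = T-isometry p (basis-offPair p≢j p≢j′ a) iso 0#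
    where
    iso : ω (a *ᵥ basis j) (a *ᵥ basis j) ≈ 0#
    iso = begin
      ω (a *ᵥ basis j) (a *ᵥ basis j)        ≈⟨ ω-*basisˡ a j _ ⟩
      a * (τ j * (a * δ (j +m) j))           ≈⟨ *-congˡ (*-congˡ (*-congˡ (δ-≢ (+m-≢ j)))) ⟩
      a * (τ j * (a * 0#))                   ≈⟨ solve 2 (λ a τ → a :* (τ :* (a :* con (+ 0))) := con (+ 0)) refl
          a (τ j) ⟩
      0#                                     ∎

  T-0-isometry : ∀ p c → IsIsometry (T p 0ᵥ c)
  T-0-isometry p c = T-isometry p (offPair refl refl)
    (ω-0ˡ 0ᵥ λ i → refl) c

  -- Realization of transvections by row operations

  -- A record rather than a synonym, so that F and P can be inferred.
  record Acts (F : Vec → Vec) (P : Matrix) : Set (c ⊔ ℓ) where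
    constructor acts-by
    field apply : ∀ A → P · A ≋ onColumns F A
  open Acts

  acts-cong : ∀ {F G P} → (∀ v i → F v i ≈ G v i) → Acts F P → Acts G P
  acts-cong F≈G (acts-by acts) = acts-by λ A i l → trans (acts A i l) (F≈G _ i)

  acts-· : ∀ {F G P Q} → Acts F P → Acts G Q → Acts (F ∘ G) (P · Q)
  acts-· {F} {G} {P} {Q} (acts-by actsP) (acts-by actsQ) = acts-by λ A i l → begin
    ((P · Q) · A) i l          ≈⟨ ·-assoc P Q A i l ⟩
    (P · (Q · A)) i l          ≈⟨ ·-cong {P} {P} (λ _ _ → refl) (actsQ A) i l ⟩
    (P · onColumns G A) i l    ≈⟨ actsP (onColumns G A) i l ⟩
    onColumns (F ∘ G) A i l    ∎

  acts-𝟙 : Acts id 𝟙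
  acts-𝟙 = acts-by ·-identityˡ

  -- The columns of `P` are the images of the basis vectors under `F`. In this way `ActsOnSp` is
  -- verified without multiplying out matrices.
  acts-isometry⇒symplectic : ∀ {F P} → Acts F P → IsIsometry F → IsSymplectic P
  acts-isometry⇒symplectic {F} {P} (acts-by acts) iso = symplectic-cong {onColumns F 𝟙} {P}
    (λ i j → trans (sym (acts 𝟙 i j)) (·-identityʳ P i j))
    (isometry-symplectic {F} {𝟙} iso 𝟙-symplectic)

  -- The isometry property travels with the factorization, because it is proved directly only for
  -- the factors.
  record Realizable (N : ℕ) (F : Vec → Vec) : Set (c ⊔ ℓ) where
    field
      ops      : List RowOperation
      actsOnSp : All ActsOnSp ops
      length≤  : length ops ≤ N
      acts     : Acts F (Unit.value (product ops))
      isometry : IsIsometry F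
  open Realizable

  realizable-cong : ∀ {N F G} → (∀ v i → F v i ≈ G v i) → Realizable N F → Realizable N G
  realizable-cong F≈G r = record
    { ops = ops r ; actsOnSp = actsOnSp r ; length≤ = length≤ r
    ; acts = acts-cong F≈G (acts r)
    ; isometry = λ v w → trans (sym (ω-cong (F≈G v) (F≈G w))) (isometry r v w) }

  realizable-≤ : ∀ {M N F} → M ≤ N → Realizable M F → Realizable N F
  realizable-≤ M≤N r = record
    { ops = ops r ; actsOnSp = actsOnSp r ; length≤ = ℕ.≤-trans (length≤ r) M≤N
    ; acts = acts r ; isometry = isometry r }

  realizable-id : Realizable 0 id
  realizable-id = record
    { ops = [] ; actsOnSp = [] ; length≤ = ℕ.z≤n ; acts = acts-𝟙 ; isometry = λ v w → refl }

  product-++ : ∀ xs ys → Unit.value (product (xs ++ ys)) ≋ Unit.value (product xs) · Unit.value (product ys)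
  product-++ []       ys i j = sym (·-identityˡ (Unit.value (product ys)) i j)
  product-++ (x ∷ xs) ys i j = trans
    (·-cong {Unit.value ⟦ x ⟧} {Unit.value ⟦ x ⟧} (λ _ _ → refl) (product-++ xs ys) i j)
    (sym (·-assoc (Unit.value ⟦ x ⟧) (Unit.value (product xs)) (Unit.value (product ys)) i j))

  realizable-∘ : ∀ {M N F G} → Realizable M F → Realizable N G → Realizable (M ℕ.+ N) (F ∘ G)
  realizable-∘ r s = record
    { ops      = ops r ++ ops s
    ; actsOnSp = All.++⁺ (actsOnSp r) (actsOnSp s)
    ; length≤  = ℕ.≤-trans (ℕ.≤-reflexive (List.length-++ (ops r))) (ℕ.+-mono-≤ (length≤ r) (length≤ s))
    ; acts     = acts-by λ A i l → trans
        (·-cong {D = A} (product-++ (ops r) (ops s)) (λ _ _ → refl) i l)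
        (apply (acts-· (acts r) (acts s)) A i l)
    ; isometry = λ v w → trans (isometry r _ _) (isometry s v w)
    }

  realizable-op : ∀ {F} op → Acts F (Unit.value ⟦ op ⟧) → IsIsometry F → Realizable 1 F
  realizable-op op acts iso = record
    { ops      = op ∷ []
    ; actsOnSp = acts-isometry⇒symplectic acts iso ∷ []
    ; length≤  = ℕ.≤-refl
    ; acts     = acts-· acts acts-𝟙
    ; isometry = iso
    }

  weight : Index → Unit× → Vec
  weight j α i = if does (i ≟ j) then Unit.value α else if does (i ≟ j +m) then Unit.inverse α else 1#

  scale : Vec → Vec → Vec
  scale d v i = d i * v i

  acts-M : ∀ j α → Acts (scale (weight j α)) (Unit.value (M j α))
  acts-M j α = acts-by λ A i l → trans (·-assoc (scaleRow j (Unit.value α) 𝟙)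
      (scaleRow (j +m) (Unit.inverse α) 𝟙) A i l)
    (trans (·-cong {scaleRow j (Unit.value α) 𝟙} {scaleRow j (Unit.value α) 𝟙} (λ _ _ → refl)
        (scaleRow-· (j +m) (Unit.inverse α) A) i l)
    (trans (scaleRow-· j (Unit.value α) (scaleRow (j +m) (Unit.inverse α) A) i l) (go A i l)))
    where
    go : ∀ A i l → scaleRow j (Unit.value α) (scaleRow (j +m) (Unit.inverse α) A) i l ≈ weight j α i * A i l
    go A i l with i ≟ j | i ≟ j +m
    ... | yes i≡j | yes i≡j′ = contradiction (≡.trans (≡.sym i≡j′) i≡j) (+m-≢ j)
    ... | yes _   | no  _    = refl
    ... | no  _   | yes _    = refl
    ... | no  _   | no  _    = sym (*-identityˡ _)

  weight-at : ∀ j α → weight j α j ≈ Unit.value α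
  weight-at j α with j ≟ j
  ... | yes _   = refl
  ... | no  j≢j = contradiction ≡.refl j≢j

  weight-at′ : ∀ j α → weight j α (j +m) ≈ Unit.inverse α
  weight-at′ j α with j +m ≟ j | j +m ≟ j +m
  ... | yes eq | _       = contradiction eq (+m-≢ j)
  ... | no  _  | yes _   = refl
  ... | no  _  | no  neq = contradiction ≡.refl neq

  weight-off : ∀ {i j} α → i ≢ j → i ≢ j +m → weight j α i ≈ 1#
  weight-off {i} {j} α i≢j i≢j′ with i ≟ j | i ≟ j +m
  ... | yes eq | _      = contradiction eq i≢j
  ... | no  _  | yes eq = contradiction eq i≢j′
  ... | no  _  | no  _  = refl

  pair-elim : ∀ {p} j (P : Index → Set p) → P j → P (j +m) → (∀ i → i ≢ j → i ≢ j +m → P i) → ∀ i → P i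
  pair-elim j P at at′ off i with i ≟ j | i ≟ j +m
  ... | yes ≡.refl | _          = at
  ... | no  _      | yes ≡.refl = at′
  ... | no  i≢j    | no  i≢j′   = off i i≢j i≢j′

  inverse× : Unit× → Unit×
  inverse× = Group._⁻¹ R×

  weight-inverse : ∀ j α i → weight j α i * weight j (inverse× α) i ≈ 1#
  weight-inverse j α = pair-elim j _
    (trans (*-cong (weight-at j α) (weight-at j (inverse× α))) (Unit.inverse-r α))
    (trans (*-cong (weight-at′ j α) (weight-at′ j (inverse× α))) (Unit.inverse-l α))
    (λ i i≢j i≢j′ → trans (*-cong (weight-off α i≢j i≢j′) (weight-off (inverse× α) i≢j i≢j′)) (*-identityˡ 1#))

  weight-+m : ∀ j α i → weight j (inverse× α) i ≈ weight j α (i +m)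
  weight-+m j α = pair-elim j _
    (trans (weight-at j (inverse× α)) (sym (weight-at′ j α)))
    (trans (weight-at′ j (inverse× α)) (sym (trans (reflexive (≡.cong (weight j α) (+m-involutive j)))
        (weight-at j α))))
    (λ i i≢j i≢j′ → trans (weight-off (inverse× α) i≢j i≢j′) (sym (weight-off α
      (λ eq → i≢j′ (≡.trans (≡.sym (+m-involutive i)) (≡.cong _+m eq)))
      (+m-distinct (i≢j ∘ ≡.sym)))))

  -- `ω` pairs row `s` with row `s +m`, and the weights of these two rows are mutually inverse; so
  -- the adjoint of the scaling is its inverse.
  ω-scaleʳ : ∀ j α v w → ω v (scale (weight j (inverse× α)) w) ≈ ω (scale (weight j α) v) w
  ω-scaleʳ j α v w = begin
    ω v (scale d⁻¹ w)
      ≈⟨ ω-sum v (scale d⁻¹ w) ⟩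
    sum (λ s → v s * (τ s * (d⁻¹ (s +m) * w (s +m))))
      ≈⟨ sum-cong-≋ {m ℕ.+ m} (λ s → trans
           (*-congˡ (*-congˡ (*-congʳ (trans (weight-+m j α (s +m)) (reflexive (≡.cong d (+m-involutive s)))))))
           (solve 4 (λ v τ d w → v :* (τ :* (d :* w)) := (d :* v) :* (τ :* w)) refl (v s) (τ s) (d s) (w (s +m)))) ⟩
    sum (λ s → (d s * v s) * (τ s * w (s +m)))
      ≈⟨ ω-sum (scale d v) w ⟨
    ω (scale d v) w
      ∎
    where
    d = weight j α
    d⁻¹ = weight j (inverse× α)

  scale-isometry : ∀ j α → IsIsometry (scale (weight j α))
  scale-isometry j α v w = trans (sym (ω-scaleʳ j α v (scale (weight j α) w)))
    (ω-cong (λ i → refl) (λ i → trans (sym (*-assoc _ _ _))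
      (trans (*-congʳ (trans (*-comm _ _) (weight-inverse j α i))) (*-identityˡ _))))

  realizable-M : ∀ j α → Realizable 1 (scale (weight j α))
  realizable-M j α = realizable-op (opM j α) (acts-M j α) (scale-isometry j α)

  -- The scaling at `p +m` multiplies row `p +m` by `α` and row `p` by its inverse, and it fixes
  -- `t`. Under conjugation the pivot `v p` acquires a factor `α` before `T` acts, and
  -- `basis (p +m)` another one afterwards. The term in `t` meets only the first factor, the term in
  -- `c` meets both.
  realizable-conjugate : ∀ {N} p {t c} (α : Unit×) → OffPair p t → Realizable N (T p t c) →
    Realizable (1 ℕ.+ (N ℕ.+ 1)) (T p (Unit.value α *ᵥ t) (Unit.value α * Unit.value α * c))
  realizable-conjugate p {t} {c} α off r = realizable-cong conj
    (realizable-∘ (realizable-M (p +m) α) (realizable-∘ r (realizable-M (p +m) (inverse× α))))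
    where
    a = Unit.value α
    d = weight (p +m) α
    d⁻¹ = weight (p +m) (inverse× α)
    dt : ∀ i → d i * t i ≈ t i
    dt = pair-elim p _
      (trans (*-congˡ (at-p off)) (trans (zeroʳ _) (sym (at-p off))))
      (trans (*-congˡ (at-p′ off)) (trans (zeroʳ _) (sym (at-p′ off))))
      (λ i i≢p i≢p′ → trans (*-congʳ (weight-off α i≢p′ (λ eq → i≢p (≡.trans eq (+m-involutive p)))))
          (*-identityˡ _))
    d⁻¹p : d⁻¹ p ≈ a
    d⁻¹p = trans (reflexive (≡.cong d⁻¹ (≡.sym (+m-involutive p)))) (weight-at′ (p +m) (inverse× α))
    form : ∀ v → ω t (scale d⁻¹ v) ≈ ω t v
    form v = trans (ω-scaleʳ (p +m) α t v) (ω-cong dt (λ _ → refl))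
    conj : ∀ v i → scale d (T p t c (scale d⁻¹ v)) i ≈ T p (a *ᵥ t) (a * a * c) v i
    conj v i = begin
      d i * ((d⁻¹ i * v i + d⁻¹ p * v p * t i) + (c * (d⁻¹ p * v p) - τ p * ω t (scale d⁻¹ v)) * b)
        ≈⟨ *-congˡ (+-cong (+-congˡ (*-congʳ (*-congʳ d⁻¹p)))
            (*-congʳ (+-cong (*-congˡ (*-congʳ d⁻¹p)) (-‿cong (*-congˡ (form v)))))) ⟩
      d i * ((d⁻¹ i * v i + a * v p * t i) + (c * (a * v p) - τ p * ω t v) * b)
        ≈⟨ solve 10 (λ d d′ x a y s c τ o b →
             d :* ((d′ :* x :+ a :* y :* s) :+ (c :* (a :* y) :- τ :* o) :* b)
             := ((d :* d′) :* x :+ y :* (a :* (d :* s))) :+ (c :* (a :* y) :- τ :* o) :* (d :* b))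
           refl (d i) (d⁻¹ i) (v i) a (v p) (t i) c (τ p) (ω t v) b ⟩
      ((d i * d⁻¹ i) * v i + v p * (a * (d i * t i))) + (c * (a * v p) - τ p * ω t v) * (d i * b)
        ≈⟨ +-cong (+-cong (trans (*-congʳ (weight-inverse (p +m) α i)) (*-identityˡ _)) (*-congˡ (*-congˡ (dt i))))
                  (*-congˡ (trans (*δ-subst d i (p +m)) (*-congʳ (weight-at (p +m) α)))) ⟩
      (v i + v p * (a * t i)) + (c * (a * v p) - τ p * ω t v) * (a * b)
        ≈⟨ solve 8 (λ x y a s c τ o b → (x :+ y :* (a :* s)) :+ (c :* (a :* y) :- τ :* o) :* (a :* b)
             := (x :+ y :* (a :* s)) :+ (a :* a :* c :* y :- τ :* (a :* o)) :* b)
           refl (v i) (v p) a (t i) c (τ p) (ω t v) b ⟩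
      (v i + v p * (a * t i)) + (a * a * c * v p - τ p * (a * ω t v)) * b
        ≈⟨ +-congˡ (*-congʳ (+-congˡ (-‿cong (*-congˡ (ω-*ˡ a t v))))) ⟨
      T p (a *ᵥ t) (a * a * c) v i
        ∎
      where b = basis (p +m) i

-- Unipotents as products of symplectic row operations

module Generation {c ℓ} (R : CommutativeRing c ℓ) (m : ℕ) where
  open CommutativeRing R hiding (zero)
  open RingProperties ring
  open SemiringSum semiring
    using (sum; sum-cong-≋; sum-replicate-zero)
  open Symplectic R m
  open SymplecticForm R m
  open Transvections R m
  open UnitSquares R
  open IntegerSolver R
  open SetoidReasoning setoid

  addRow-basis : ∀ a j k A i l → addRow a j k A i l ≈ A i l + a * A j l * δ i k
  addRow-basis a j k A i l with i ≟ k
  ... | yes _ = +-congˡ (sym (*-identityʳ _))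
  ... | no  _ = sym (trans (+-congˡ (zeroʳ _)) (+-identityʳ _))

  acts-addRow : ∀ a j k → Acts (λ v i → v i + a * v j * δ i k) (addRow a j k 𝟙)
  acts-addRow a j k = acts-by λ A i l → trans (addRow-· a j k A i l) (addRow-basis a j k A i l)

  acts-addRow-pair : ∀ p a → Acts (T p 0ᵥ a) (addRow a p (p +m) 𝟙)
  acts-addRow-pair p a = acts-cong eq (acts-addRow a p (p +m))
    where
    eq : ∀ v i → v i + a * v p * δ i (p +m) ≈ T p 0ᵥ a v i
    eq v i = sym (trans
      (+-congˡ (*-congʳ (+-congˡ (-‿cong (*-congˡ (ω-0ˡ v (λ _ → refl)))))))
      (solve 5 (λ x y a τ d → (x :+ y :* con (+ 0)) :+ (a :* y :- τ :* con (+ 0)) :* d := x :+ a :* y :* d)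
        refl (v i) (v p) a (τ p) (δ i (p +m))))

  module _ {p k} (p≢k : p ≢ k) (p≢k′ : p ≢ k +m) (a b : Carrier) (b≈ : b ≈ - (τ p * τ k) * a) where
    private
      T-basis : ∀ v i → (v i + a * v p * δ i k) + b * v (k +m) * δ i (p +m) ≈ T p (a *ᵥ basis k) 0# v i
      T-basis v i = begin
        (v i + a * v p * δ i k) + b * v (k +m) * δ i (p +m)
          ≈⟨ +-congˡ (*-congʳ (*-congʳ b≈)) ⟩
        (v i + a * v p * δ i k) + - (τ p * τ k) * a * v (k +m) * δ i (p +m)
          ≈⟨ solve 8 (λ x y z a d d′ τ τ′ → (x :+ a :* y :* d) :+ :- (τ :* τ′) :* a :* z :* d′
               := (x :+ y :* (a :* d)) :+ (con (+ 0) :* y :- τ :* (a :* (τ′ :* z))) :* d′)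
             refl (v i) (v p) (v (k +m)) a (δ i k) (δ i (p +m)) (τ p) (τ k) ⟩
        (v i + v p * (a * δ i k)) + (0# * v p - τ p * (a * (τ k * v (k +m)))) * δ i (p +m)
          ≈⟨ +-congˡ (*-congʳ (+-congˡ (-‿cong (*-congˡ (ω-*basisˡ a k v))))) ⟨
        T p (a *ᵥ basis k) 0# v i
          ∎

    acts-addRows : Acts (T p (a *ᵥ basis k) 0#) (addRow a p k 𝟙 · addRow b (k +m) (p +m) 𝟙)
    acts-addRows = acts-cong eq (acts-· (acts-addRow a p k) (acts-addRow b (k +m) (p +m)))
      where
      eq : ∀ v i → (v i + b * v (k +m) * δ i (p +m)) + a * (v p + b * v (k +m) * δ p (p +m)) * δ i k
                   ≈ T p (a *ᵥ basis k) 0# v i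
      eq v i = trans
        (trans (+-congˡ (*-congʳ (*-congˡ (+-congˡ (*-congˡ (δ-≢ (+m-≢ p ∘ ≡.sym)))))))
          (solve 7 (λ x y z a b d d′ → (x :+ b :* z :* d′) :+ a :* (y :+ b :* z :* con (+ 0)) :* d
            := (x :+ a :* y :* d) :+ b :* z :* d′) refl (v i) (v p) (v (k +m)) a b (δ i k) (δ i (p +m))))
        (T-basis v i)

    -- The inverse of a product in `GL` reverses the factors, so the inverse of `C` has its row
    -- additions in this order.
    acts-addRows′ : Acts (T p (a *ᵥ basis k) 0#) (addRow b (k +m) (p +m) 𝟙 · addRow a p k 𝟙)
    acts-addRows′ = acts-cong eq (acts-· (acts-addRow b (k +m) (p +m)) (acts-addRow a p k))
      where
      eq : ∀ v i → (v i + a * v p * δ i k) + b * (v (k +m) + a * v p * δ (k +m) k) * δ i (p +m)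
                   ≈ T p (a *ᵥ basis k) 0# v i
      eq v i = trans
        (+-congˡ (*-congʳ (*-congˡ (trans (+-congˡ (trans (*-congˡ (δ-≢ (+m-≢ k))) (zeroʳ _))) (+-identityʳ _)))))
        (T-basis v i)

  -- An isometry forces the coefficient `- (τ p * τ k) * a` on the second row addition. This matches
  -- it with the case distinction in `C`.
  sameHalf-τ : ∀ p k → τ p * τ k ≈ (if sameHalf p k then 1# else - 1#)
  sameHalf-τ p k with splitAt m p | splitAt m k
  ... | inj₁ _ | inj₁ _ = trans (-1*x≈-x (- 1#)) (-‿involutive 1#)
  ... | inj₁ _ | inj₂ _ = *-identityʳ _
  ... | inj₂ _ | inj₁ _ = *-identityˡ _
  ... | inj₂ _ | inj₂ _ = *-identityˡ _

  if-true : ∀ {a} {A : Set a} {b} {x y : A} → b ≡ true → (if b then x else y) ≡ x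
  if-true ≡.refl = ≡.refl

  if-false : ∀ {a} {A : Set a} {b} {x y : A} → b ≡ false → (if b then x else y) ≡ y
  if-false ≡.refl = ≡.refl

  C-pair : ∀ {p k} (p≢k : p ≢ k) → p ≡ k +m → C p k p≢k ≡ χ p k p≢k
  C-pair {p} {k} p≢k p≡k′ = if-true (dec-true (p ≟ k +m) p≡k′)

  C-offPair : ∀ {p k} (p≢k : p ≢ k) → p ≢ k +m → C p k p≢k ≡
    (if sameHalf p k
     then Group._∙_ GL (χ p k p≢k) (Group._⁻¹ GL (χ (k +m) (p +m) (+m-distinct p≢k)))
     else Group._∙_ GL (χ p k p≢k) (χ (k +m) (p +m) (+m-distinct p≢k)))
  C-offPair {p} {k} p≢k p≢k′ = if-false (dec-false (p ≟ k +m) p≢k′)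

  acts-C-offPair : ∀ {p k} (p≢k : p ≢ k) → p ≢ k +m →
    Acts (T p (1# *ᵥ basis k) 0#) (Unit.value (C p k p≢k)) ×
    Acts (T p (- 1# *ᵥ basis k) 0#) (Unit.inverse (C p k p≢k))
  acts-C-offPair {p} {k} p≢k p≢k′ rewrite C-offPair p≢k p≢k′ with sameHalf p k in same
  ... | true  = acts-addRows  p≢k p≢k′ 1# (- 1#) (sym (trans (*-identityʳ _) (-‿cong ττ)))
              , acts-addRows′ p≢k p≢k′ (- 1#) 1# (sym (trans (*-congʳ (-‿cong ττ))
                  (trans (-1*x≈-x (- 1#)) (-‿involutive 1#))))
    where
    ττ : τ p * τ k ≈ 1#
    ττ = trans (sameHalf-τ p k) (reflexive (≡.cong (λ b → if b then 1# else - 1#) same))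
  ... | false = acts-addRows  p≢k p≢k′ 1# 1# (sym (trans (*-identityʳ _) (trans (-‿cong ττ) (-‿involutive 1#))))
              , acts-addRows′ p≢k p≢k′ (- 1#) (- 1#) (sym
                  (trans (*-congʳ (trans (-‿cong ττ) (-‿involutive 1#))) (*-identityˡ _)))
    where
    ττ : τ p * τ k ≈ - 1#
    ττ = trans (sameHalf-τ p k) (reflexive (≡.cong (λ b → if b then 1# else - 1#) same))

  module _ {p k} (p≢k : p ≢ k) (p≢k′ : p ≢ k +m) where

    realizable-C : Realizable 1 (T p (1# *ᵥ basis k) 0#)
    realizable-C = realizable-op (opC p k p≢k) (proj₁ (acts-C-offPair p≢k p≢k′)) (T-basis-isometry p≢k p≢k′ 1#)

    realizable-C⁻¹ : Realizable 1 (T p (- 1# *ᵥ basis k) 0#)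
    realizable-C⁻¹ = realizable-op (opC⁻¹ p k p≢k) (proj₂ (acts-C-offPair p≢k p≢k′))
        (T-basis-isometry p≢k p≢k′ (- 1#))

  private
    partner-≢ : ∀ p → p ≢ p +m
    partner-≢ p eq = +m-≢ p (≡.sym eq)

  realizable-C-pair : ∀ p → Realizable 1 (T p 0ᵥ 1#)
  realizable-C-pair p = realizable-op (opC p (p +m) (partner-≢ p))
    (≡.subst (Acts (T p 0ᵥ 1#) ∘ Unit.value) (≡.sym (C-pair (partner-≢ p) (≡.sym (+m-involutive p))))
        (acts-addRow-pair p 1#))
    (T-0-isometry p 1#)

  realizable-C-pair⁻¹ : ∀ p → Realizable 1 (T p 0ᵥ (- 1#))
  realizable-C-pair⁻¹ p = realizable-op (opC⁻¹ p (p +m) (partner-≢ p))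
    (≡.subst (Acts (T p 0ᵥ (- 1#)) ∘ Unit.inverse) (≡.sym (C-pair (partner-≢ p) (≡.sym (+m-involutive p))))
        (acts-addRow-pair p (- 1#)))
    (T-0-isometry p (- 1#))

  -- For an additive one-parameter family, each term of the sum becomes one factor. Its three
  -- operations are a `C` or an inverse of `C` between two `M`.
  realizable-unitSquareSum : (F : Carrier → Vec → Vec) →
    (∀ {a b} → a ≈ b → ∀ v i → F a v i ≈ F b v i) →
    (∀ {a} → a ≈ 0# → ∀ v i → F a v i ≈ v i) →
    (∀ a b v i → F a (F b v) i ≈ F (a + b) v i) →
    (∀ u → Realizable 3 (F (Unit.value u * Unit.value u)) × Realizable 3 (F (- (Unit.value u * Unit.value u)))) →
    ∀ {N a} → UnitSquareSum N a → Realizable (N ℕ.* 3) (F a)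
  realizable-unitSquareSum F F-cong F-0 F-+ square = go
    where
    go : ∀ {N a} → UnitSquareSum N a → Realizable (N ℕ.* 3) (F a)
    go (none a≈0)       = realizable-≤ ℕ.z≤n (realizable-cong (λ v i → sym (F-0 a≈0 v i)) realizable-id)
    go (plus u b≈ sum)  = realizable-cong (λ v i → trans (F-+ _ _ v i) (F-cong (sym b≈) v i))
                            (realizable-∘ (proj₁ (square u)) (go sum))
    go (minus u b≈ sum) = realizable-cong (λ v i → trans (F-+ _ _ v i) (F-cong (sym b≈) v i))
                            (realizable-∘ (proj₂ (square u)) (go sum))

  -- Conjugation by `α` scales the coefficient of `basis k` by `α` only once. With `α = u²`, both
  -- kinds of elementary unipotent are built from the same sums of squares.
  square-unit : Unit× → Unit×
  square-unit u = Group._∙_ R× u u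

  module _ {p k} (p≢k : p ≢ k) (p≢k′ : p ≢ k +m) where

    realizable-T-basis : ∀ {N a} → UnitSquareSum N a → Realizable (N ℕ.* 3) (T p (a *ᵥ basis k) 0#)
    realizable-T-basis = realizable-unitSquareSum (λ a → T p (a *ᵥ basis k) 0#)
      (λ a≈b v → T-cong p (λ j → *-congʳ a≈b) refl (λ _ → refl))
      (λ a≈0 v → T-identity p v (λ j → trans (*-congʳ a≈0) (zeroˡ _)) refl)
      (λ a b v i → trans (T-∘ p (off a) (off b) 0# 0# v i)
        (T-cong p (λ j → sym (distribʳ _ a b)) (c≈0 a b) (λ _ → refl) i))
      (λ u → realizable-cong (λ v → T-cong p (λ j → trans (sym (*-assoc _ _ _)) (*-congʳ (*-identityʳ _)))
          (zeroʳ _) (λ _ → refl))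
               (realizable-conjugate p (square-unit u) (off 1#) (realizable-C p≢k p≢k′))
           , realizable-cong (λ v → T-cong p (λ j → trans (sym (*-assoc _ _ _))
               (*-congʳ (solve 1 (λ x → x :* :- con (+ 1) := :- x) refl _))) (zeroʳ _) (λ _ → refl))
               (realizable-conjugate p (square-unit u) (off (- 1#)) (realizable-C⁻¹ p≢k p≢k′)))
      where
      off : ∀ a → OffPair p (a *ᵥ basis k)
      off = basis-offPair p≢k p≢k′
      c≈0 : ∀ a b → 0# + 0# - τ p * ω (a *ᵥ basis k) (b *ᵥ basis k) ≈ 0#
      c≈0 a b = trans (+-congˡ (-‿cong (*-congˡ (trans (ω-*basisˡ a k (b *ᵥ basis k))
          (*-congˡ (*-congˡ (*-congˡ (δ-≢ (+m-≢ k)))))))))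
        (solve 4 (λ τ a τ′ b → con (+ 0) :+ con (+ 0) :- τ :* (a :* (τ′ :* (b :* con (+ 0)))) := con (+ 0)) refl
            (τ p) a (τ k) b)

  realizable-T-pair : ∀ p {N a} → UnitSquareSum N a → Realizable (N ℕ.* 3) (T p 0ᵥ a)
  realizable-T-pair p = realizable-unitSquareSum (T p 0ᵥ)
    (λ a≈b v → T-cong p (λ j → refl) a≈b (λ _ → refl))
    (λ a≈0 v → T-identity p v (λ j → refl) a≈0)
    (λ a b v i → trans (T-∘ p off off a b v i)
      (T-cong p (λ j → +-identityˡ 0#) (trans (+-congˡ (-‿cong
          (trans (*-congˡ (ω-0ˡ 0ᵥ λ _ → refl)) (zeroʳ _)))) (trans (+-congˡ -0#≈0#) (+-identityʳ _)))
              (λ _ → refl) i))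
    (λ u → realizable-cong (λ v → T-cong p (λ j → zeroʳ _) (*-identityʳ _) (λ _ → refl))
             (realizable-conjugate p u off (realizable-C-pair p))
         , realizable-cong (λ v → T-cong p (λ j → zeroʳ _) (solve 1 (λ x → x :* :- con (+ 1) := :- x) refl _)
             (λ _ → refl))
             (realizable-conjugate p u off (realizable-C-pair⁻¹ p)))
    where
    off : OffPair p 0ᵥ
    off = offPair refl refl

  module _ {N} (unitSquareSum : ∀ a → UnitSquareSum N a) where

    private
      K = N ℕ.* 3

      partial : ∀ {n} → Vec → (Fin n → Index) → Vec
      partial t f i = sum (λ k → t (f k) * δ i (f k))

      partial-0 : ∀ {n} t (f : Fin n → Index) {i} → t i ≈ 0# → partial t f i ≈ 0#
      partial-0 {n} t f {i} ti≈0 = trans (sum-cong-≋ {n} λ k → begin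
        t (f k) * δ i (f k)   ≈⟨ *-congˡ (δ-sym i (f k)) ⟩
        t (f k) * δ (f k) i   ≈⟨ *δ-subst t (f k) i ⟩
        t i * δ (f k) i       ≈⟨ *-congʳ ti≈0 ⟩
        0# * δ (f k) i        ≈⟨ zeroˡ _ ⟩
        0#                    ∎) (sum-replicate-zero n)

      partial-offPair : ∀ {n p t} (f : Fin n → Index) → OffPair p t → OffPair p (partial t f)
      partial-offPair {p = p} {t} f (offPair at-p at-p′) = offPair (partial-0 t f {p} at-p)
          (partial-0 t f {p +m} at-p′)

      -- The central coordinate is left existential: it is whatever the cocycles of `T-∘`
      -- accumulate. A general `f` allows the induction to pass to `f ∘ suc`.
      realizable-partial : ∀ {n} p {t} → OffPair p t → (f : Fin n → Index) →
        ∃[ c ] Realizable (n ℕ.* K) (T p (partial t f) c)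
      realizable-partial {zero} p off f = 0# , realizable-cong
          (λ v i → sym (T-identity p v (λ _ → refl) refl i)) realizable-id
      realizable-partial {suc n} p {t} off f with realizable-partial p off (f ∘ suc)
      ... | c , rest = pair-elim p
        (λ k → f zero ≡ k → ∃[ c ] Realizable (suc n ℕ.* K) (T p (partial t f) c))
        (λ eq → skip (trans (reflexive (≡.cong t eq)) (OffPair.at-p off)))
        (λ eq → skip (trans (reflexive (≡.cong t eq)) (OffPair.at-p′ off)))
        (λ { k k≢p k≢p′ ≡.refl → _ , realizable-cong (T-∘ p (first k≢p k≢p′) (partial-offPair (f ∘ suc) off) 0# c)
          (realizable-∘ (realizable-T-basis (k≢p ∘ ≡.sym) (off-pair k≢p′) (unitSquareSum (t k))) rest) })
        (f zero) ≡.refl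
        where
        off-pair : ∀ {k} → k ≢ p +m → p ≢ k +m
        off-pair k≢p′ p≡k′ = k≢p′ (≡.trans (≡.sym (+m-involutive _)) (≡.cong _+m (≡.sym p≡k′)))
        first : ∀ {k} → k ≢ p → k ≢ p +m → OffPair p (t k *ᵥ basis k)
        first k≢p k≢p′ = basis-offPair (k≢p ∘ ≡.sym) (off-pair k≢p′) _
        skip : t (f zero) ≈ 0# → ∃[ c ] Realizable (suc n ℕ.* K) (T p (partial t f) c)
        skip t≈0 = c , realizable-≤ (ℕ.m≤n+m (n ℕ.* K) K) (realizable-cong
          (λ v → T-cong p (λ i → sym (trans (+-congʳ (trans (*-congʳ t≈0) (zeroˡ _))) (+-identityˡ _))) refl
              (λ _ → refl)) rest)

    -- One elementary factor is counted for each of the `2m` coordinates, and one more central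
    -- factor corrects the accumulated `c′` to `c`.
    realizable-T : ∀ p {t} → OffPair p t → ∀ c → Realizable ((1 ℕ.+ (m ℕ.+ m)) ℕ.* K) (T p t c)
    realizable-T p {t} off c with realizable-partial p off id
    ... | c′ , r = realizable-cong
      (λ v i → trans (T-∘ p (offPair refl refl) (partial-offPair id off) (c - c′) c′ v i)
        (T-cong p (λ i → trans (+-identityˡ _) (partial-id i)) c≈ (λ _ → refl) i))
      (realizable-∘ (realizable-T-pair p (unitSquareSum (c - c′))) r)
      where
      partial-id : ∀ i → partial t id i ≈ t i
      partial-id i = trans (sum-cong-≋ {m ℕ.+ m} λ k → *-congˡ (δ-sym i k)) (sum-*δ t i)
      c≈ : c - c′ + c′ - τ p * ω 0ᵥ (partial t id) ≈ c
      c≈ = trans (+-congˡ (-‿cong (*-congˡ (ω-0ˡ (partial t id) λ _ → refl))))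
        (solve 3 (λ c c′ τ → c :- c′ :+ c′ :- τ :* con (+ 0) := c) refl c c′ (τ p))

-- Reduction of a symplectic matrix to the identity

module Reduction {c ℓ} (R : CommutativeRing c ℓ) (m : ℕ) where
  open CommutativeRing R hiding (zero)
  open RingProperties ring
  open Symplectic R m
  open SymplecticForm R m
  open Transvections R m
  open Generation R m
  open UnitSquares R
  open IntegerSolver R
  open SetoidReasoning setoid

  column : Matrix → Index → Vec
  column A l i = A i l

  FixedColumn : Matrix → Index → Set ℓ
  FixedColumn A b = ∀ i → A i b ≈ δ i b

  FixedPair : Matrix → Index → Set ℓ
  FixedPair A b = FixedColumn A b × FixedColumn A (b +m)

  fixedPair-+m : ∀ {A} b → FixedPair A b → FixedPair A (b +m)
  fixedPair-+m {A} b (fixed , fixed′) = fixed′ , ≡.subst (FixedColumn A) (≡.sym (+m-involutive b)) fixed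

  -- Pairing a column with `basis b` reads off its entry in row `b +m`, and symplecticity prescribes
  -- that pairing. The trivial row is thus the partner of the fixed column.
  fixedColumn⇒row : ∀ {A} → IsSymplectic A → ∀ b → FixedColumn A b → ∀ l → A (b +m) l ≈ δ (b +m) l
  fixedColumn⇒row {A} symp b fixed l = τ*-cancel b _ _ (begin
    τ b * A (b +m) l             ≈⟨ ω-basisˡ b (column A l) ⟨
    ω (basis b) (column A l)     ≈⟨ ω-cong fixed (λ _ → refl) ⟨
    ω (column A b) (column A l)  ≈⟨ symp b l ⟩
    σ b l                        ≈⟨ σ-τ b l ⟩
    τ b * δ (b +m) l             ∎)

  module _ {A} (symp : IsSymplectic A) {b l} (b≢l : b ≢ l) (b≢l′ : b ≢ l +m) (fixed : FixedPair A b) where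

    fixedPair⇒entry′ : A (b +m) l ≈ 0#
    fixedPair⇒entry′ = trans (fixedColumn⇒row symp b (proj₁ fixed) l)
      (δ-≢ λ eq → b≢l′ (≡.trans (≡.sym (+m-involutive b)) (≡.cong _+m eq)))

    fixedPair⇒entry : A b l ≈ 0#
    fixedPair⇒entry = ≡.subst (λ i → A i l ≈ 0#) (+m-involutive b)
      (trans (fixedColumn⇒row symp (b +m) (proj₂ fixed) l)
        (δ-≢ λ eq → b≢l (≡.trans (≡.sym (+m-involutive b)) eq)))

  infix 4 _⟶[_]_
  -- The operations lead from `B` back to `A`. Hence a chain from `S` to `𝟙` is a factorization of
  -- `S` itself, and each step realizes the inverse of the unipotent that it applies.
  record _⟶[_]_ (A : Matrix) (N : ℕ) (B : Matrix) : Set (c ⊔ ℓ) where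
    field
      ops      : List RowOperation
      actsOnSp : All ActsOnSp ops
      length≤  : length ops ≤ N
      factors  : Unit.value (product ops) · B ≋ A
  open _⟶[_]_

  ⟶-refl : ∀ {A} → A ⟶[ 0 ] A
  ⟶-refl {A} = record { ops = [] ; actsOnSp = [] ; length≤ = ℕ.z≤n ; factors = ·-identityˡ A }

  ⟶-trans : ∀ {A B C M N} → A ⟶[ M ] B → B ⟶[ N ] C → A ⟶[ M ℕ.+ N ] C
  ⟶-trans {A} {B} {C} r s = record
    { ops      = ops r ++ ops s
    ; actsOnSp = All.++⁺ (actsOnSp r) (actsOnSp s)
    ; length≤  = ℕ.≤-trans (ℕ.≤-reflexive (List.length-++ (ops r))) (ℕ.+-mono-≤ (length≤ r) (length≤ s))
    ; factors  = λ i j → begin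
        (P++ · C) i j         ≈⟨ ·-cong {P++} {P · Q} {C} {C} (product-++ (ops r) (ops s)) (λ _ _ → refl) i j ⟩
        ((P · Q) · C) i j     ≈⟨ ·-assoc P Q C i j ⟩
        (P · (Q · C)) i j     ≈⟨ ·-cong {P} {P} {Q · C} {B} (λ _ _ → refl) (factors s) i j ⟩
        (P · B) i j           ≈⟨ factors r i j ⟩
        A i j                 ∎
    }
    where
    P = Unit.value (product (ops r))
    Q = Unit.value (product (ops s))
    P++ = Unit.value (product (ops r ++ ops s))

  ⟶-≤ : ∀ {A B M N} → M ≤ N → A ⟶[ M ] B → A ⟶[ N ] B
  ⟶-≤ M≤N r = record
    { ops = ops r ; actsOnSp = actsOnSp r ; length≤ = ℕ.≤-trans (length≤ r) M≤N ; factors = factors r }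

  record Step (p : Index) (N : ℕ) (A B : Matrix) : Set (c ⊔ ℓ) where
    field
      reach      : A ⟶[ N ] B
      symplectic : IsSymplectic B
      preserves  : ∀ {b} → b ≢ p → b ≢ p +m → FixedPair A b → FixedPair B b
  open Step

  step-trans : ∀ {p M N A B C} → Step p M A B → Step p N B C → Step p (M ℕ.+ N) A C
  step-trans r s = record
    { reach      = ⟶-trans (reach r) (reach s)
    ; symplectic = symplectic s
    ; preserves  = λ b≢p b≢p′ → preserves s b≢p b≢p′ ∘ preserves r b≢p b≢p′
    }

  step-+m : ∀ {p N A B} → Step (p +m) N A B → Step p N A B
  step-+m {p} s = record
    { reach      = reach s
    ; symplectic = symplectic s
    ; preserves  = λ b≢p b≢p′ → preserves s b≢p′ (λ eq → b≢p (≡.trans eq (+m-involutive p)))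
    }

  -- Deleting the two coordinates by subtracting basis vectors, rather than by cases, lets
  -- `ω-linearˡ` evaluate `ω (off p w)`.
  off : Index → Vec → Vec
  off p w i = (w i + - w p * basis p i) + - w (p +m) * basis (p +m) i

  off-offPair : ∀ p w → OffPair p (off p w)
  off-offPair p w = offPair
    (trans (+-cong (+-congˡ (*-congˡ (δ-≡ {i = p} ≡.refl))) (*-congˡ (δ-≢ (+m-≢ p ∘ ≡.sym))))
      (solve 2 (λ x y → (x :+ :- x :* con (+ 1)) :+ :- y :* con (+ 0) := con (+ 0)) refl (w p) (w (p +m))))
    (trans (+-cong (+-congˡ (*-congˡ (δ-≢ (+m-≢ p)))) (*-congˡ (δ-≡ {i = p +m} ≡.refl)))
      (solve 2 (λ x y → (y :+ :- x :* con (+ 0)) :+ :- y :* con (+ 1) := con (+ 0)) refl (w p) (w (p +m))))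

  off-entry : ∀ p w {i} → i ≢ p → i ≢ p +m → w i ≈ 0# → off p w i ≈ 0#
  off-entry p w {i} i≢p i≢p′ wi≈0 = trans
    (+-cong (+-cong wi≈0 (*-congˡ (δ-≢ i≢p))) (*-congˡ (δ-≢ i≢p′)))
    (solve 2 (λ x y → (con (+ 0) :+ :- x :* con (+ 0)) :+ :- y :* con (+ 0) := con (+ 0)) refl (w p) (w (p +m)))

  *ᵥ-offPair : ∀ {p t} a → OffPair p t → OffPair p (a *ᵥ t)
  *ᵥ-offPair a (offPair at-p at-p′) = offPair (trans (*-congˡ at-p) (zeroʳ a)) (trans (*-congˡ at-p′) (zeroʳ a))

  module _ {N} (unitSquareSum : ∀ a → UnitSquareSum N a) where

    cost : ℕ
    cost = (1 ℕ.+ (m ℕ.+ m)) ℕ.* (N ℕ.* 3)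

    step-T : ∀ {A} p {t} → OffPair p t → ∀ c →
      (∀ {b} → b ≢ p → b ≢ p +m → FixedPair A b → t b ≈ 0# × t (b +m) ≈ 0#) →
      IsSymplectic A → Step p cost A (onColumns (T p t c) A)
    step-T {A} p {t} off-t c trivial symp = record
      { reach = record
        { ops      = Realizable.ops inverse
        ; actsOnSp = Realizable.actsOnSp inverse
        ; length≤  = Realizable.length≤ inverse
        ; factors  = λ i l → trans (Acts.apply (Realizable.acts inverse) (onColumns (T p t c) A) i l)
                                   (cancel (column A l) i)
        }
      ; symplectic = isometry-symplectic {T p t c} {A}
          (Realizable.isometry (realizable-T unitSquareSum p off-t c)) symp
      ; preserves = λ {b} b≢p b≢p′ fixed → let t≈0 , t′≈0 = trivial b≢p b≢p′ fixed in
            (λ i → trans (T-cong p (λ _ → refl) refl (proj₁ fixed) i) (T-fixes p b b≢p t′≈0 c i))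
          , (λ i → trans (T-cong p (λ _ → refl) refl (proj₂ fixed) i)
                (T-fixes p (b +m) (λ eq → b≢p′ (≡.trans (≡.sym (+m-involutive b)) (≡.cong _+m eq)))
                  (trans (reflexive (≡.cong t (+m-involutive b))) t≈0) c i))
      }
      where
      t⁻ : Vec
      t⁻ = - 1# *ᵥ t
      -- Chosen so that the central coordinate in `T-∘` vanishes.
      c⁻ = - c + τ p * ω t⁻ t
      inverse : Realizable cost (T p t⁻ c⁻)
      inverse = realizable-T unitSquareSum p (*ᵥ-offPair (- 1#) off-t) c⁻
      cancel : ∀ v i → T p t⁻ c⁻ (T p t c v) i ≈ v i
      cancel v i = trans (T-∘ p (*ᵥ-offPair (- 1#) off-t) off-t c⁻ c v i)
        (T-identity p v
          (λ j → solve 1 (λ x → :- con (+ 1) :* x :+ x := con (+ 0)) refl (t j))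
          (solve 2 (λ c q → :- c :+ q :+ c :- q := con (+ 0)) refl c (τ p * ω t⁻ t)) i)

    step-pair : ∀ {A} p c → IsSymplectic A → Step p cost A (onColumns (T p 0ᵥ c) A)
    step-pair p c = step-T p (offPair refl refl) c (λ _ _ _ → refl , refl)

    T-0-partner : ∀ p c v → T p 0ᵥ c v (p +m) ≈ v (p +m) + c * v p
    T-0-partner p c v = trans
      (+-congˡ (*-cong (+-congˡ (-‿cong (*-congˡ (ω-0ˡ v λ _ → refl)))) (δ-≡ {i = p +m} ≡.refl)))
      (solve 4 (λ x y c τ → (x :+ y :* con (+ 0)) :+ (c :* y :- τ :* con (+ 0)) :* con (+ 1) := x :+ c :* y)
        refl (v (p +m)) (v p) c (τ p))

    normalize-partner : ∀ {A} p l u → IsSymplectic A → A p l * u ≈ 1# →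
      ∃[ B ] Step p cost A B × B (p +m) l ≈ 1#
    normalize-partner {A} p l u symp unit =
      onColumns (T p 0ᵥ c₀) A , step-pair p c₀ symp , (begin
        T p 0ᵥ c₀ (column A l) (p +m)   ≈⟨ T-0-partner p c₀ (column A l) ⟩
        x + (1# - x) * u * y            ≈⟨ solve 3 (λ x u y → x :+ (con (+ 1) :- x) :* u :* y := x :+
            (con (+ 1) :- x) :* (y :* u)) refl x u y ⟩
        x + (1# - x) * (y * u)          ≈⟨ +-congˡ (*-congˡ unit) ⟩
        x + (1# - x) * 1#               ≈⟨ solve 1 (λ x → x :+ (con (+ 1) :- x) :* con (+ 1) := con (+ 1)) refl x ⟩
        1#                              ∎)
      where
      x = A (p +m) l
      y = A p l
      c₀ = (1# - x) * u

    off-trivial : ∀ {A} p a l → (l ≡ p ⊎ l ≡ p +m) → IsSymplectic A → ∀ {b} → b ≢ p → b ≢ p +m → FixedPair A b →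
      (a *ᵥ off p (column A l)) b ≈ 0# × (a *ᵥ off p (column A l)) (b +m) ≈ 0#
    off-trivial {A} p a l l∈ symp {b} b≢p b≢p′ fixed =
        trans (*-congˡ (off-entry p _ b≢p b≢p′ (fixedPair⇒entry symp (b≢l l∈) (b≢l′ l∈) fixed))) (zeroʳ a)
      , trans (*-congˡ (off-entry p _ b′≢p (+m-distinct (b≢p ∘ ≡.sym))
          (fixedPair⇒entry′ symp (b≢l l∈) (b≢l′ l∈) fixed))) (zeroʳ a)
      where
      b′≢p : b +m ≢ p
      b′≢p eq = b≢p′ (≡.trans (≡.sym (+m-involutive b)) (≡.cong _+m eq))
      b≢l : l ≡ p ⊎ l ≡ p +m → b ≢ l
      b≢l (inj₁ ≡.refl) = b≢p
      b≢l (inj₂ ≡.refl) = b≢p′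
      b≢l′ : l ≡ p ⊎ l ≡ p +m → b ≢ l +m
      b≢l′ (inj₁ ≡.refl) = b≢p′
      b≢l′ (inj₂ ≡.refl) eq = b≢p (≡.trans eq (+m-involutive p))

    -- As the pivot is 1, the entries off the pair are cleared by adding `t` itself, and `c₀` both
    -- cancels the `ω` term and clears the entry in row `p +m`. `T` fixes `basis (p +m)`, so a
    -- partner column that is already reduced stays so.
    clear-column : ∀ {A} p → IsSymplectic A → A p p ≈ 1# →
      ∃[ B ] Step p cost A B × FixedColumn B p × (FixedColumn A (p +m) → FixedColumn B (p +m))
    clear-column {A} p symp pivot =
        onColumns (T p t c₀) A
      , step-T p off-t c₀ (off-trivial p (- 1#) p (inj₁ ≡.refl) symp) symp
      , cleared
      , λ fixed i → trans (T-cong p (λ _ → refl) refl fixed i)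
          (T-fixes p (p +m) (+m-≢ p) (trans (reflexive (≡.cong t (+m-involutive p))) (OffPair.at-p off-t)) c₀ i)
      where
      v = column A p
      t = - 1# *ᵥ off p v
      c₀ = - v (p +m) + τ p * ω t v
      off-t : OffPair p t
      off-t = *ᵥ-offPair (- 1#) (off-offPair p v)
      cleared : ∀ i → T p t c₀ v i ≈ δ i p
      cleared i = begin
        (v i + v p * (- 1# * ((v i + - v p * δ i p) + - v (p +m) * δ i (p +m)))) + (c₀ * v p - τ p * ω t v) * δ
            i (p +m)
          ≈⟨ +-cong (+-congˡ (*-cong pivot (*-congˡ (+-congʳ (+-congˡ (*-congʳ (-‿cong pivot)))))))
                    (*-congʳ (+-congʳ (*-congˡ pivot))) ⟩
        (v i + 1# * (- 1# * ((v i + - 1# * δ i p) + - v (p +m) * δ i (p +m)))) + (c₀ * 1# - τ p * ω t v) * δ i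
            (p +m)
          ≈⟨ solve 5 (λ x y q d d′ →
               (x :+ con (+ 1) :* (:- con (+ 1) :* ((x :+ :- con (+ 1) :* d) :+ :- y :* d′)))
                 :+ ((:- y :+ q) :* con (+ 1) :- q) :* d′ := d)
             refl (v i) (v (p +m)) (τ p * ω t v) (δ i p) (δ i (p +m)) ⟩
        δ i p ∎

    module _ (stableRange1 : StableRange1) where

      -- Column p of A pairs to τ p with column p + m.  Adding θ times this pairing
      -- to the entry a of column p + m at row p + m, except for its part a b which
      -- involves a, therefore yields a + θ (1 - a b).
      unit-pivot : ∀ {A} p → IsSymplectic A → ∃[ B ] Step p cost A B × ∃[ u ] B (p +m) (p +m) * u ≈ 1#
      unit-pivot {A} p symp with stableRange1 (A (p +m) (p +m)) (A p p)
      ... | θ , u , eq =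
          -- The central coordinate cancels the summand of `ω t v` in which `w (p +m)` meets `v p`.
          onColumns (T p t (- θ * w (p +m))) A
        , step-T p (*ᵥ-offPair (- θ) (off-offPair p w)) (- θ * w (p +m))
            (off-trivial p (- θ) p (inj₁ ≡.refl) symp) symp
        , u , trans (*-congʳ entry) eq
        where
        v = column A (p +m)
        w = column A p
        t = - θ *ᵥ off p w
        p′ = p +m
        ω-wv : ω w v ≈ τ p
        ω-wv = trans (symp p p′) (trans (σ-τ p p′) (trans (*-congˡ (δ-≡ {i = p′} ≡.refl)) (*-identityʳ _)))
        form : ω t v ≈ - θ * ((τ p + - w p * (τ p * v p′)) + - w p′ * (- τ p * v p))
        form = trans (ω-*ˡ (- θ) (off p w) v) (*-congˡ (begin
          ω (off p w) v
            ≈⟨ ω-linearˡ _ (- w p′) (basis p′) v ⟩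
          ω (λ i → w i + - w p * basis p i) v + - w p′ * ω (basis p′) v
            ≈⟨ +-cong (ω-linearˡ w (- w p) (basis p) v)
                 (*-congˡ (trans (ω-basisˡ p′ v) (*-cong (τ-+m p) (reflexive (≡.cong v (+m-involutive p)))))) ⟩
          (ω w v + - w p * ω (basis p) v) + - w p′ * (- τ p * v p)
            ≈⟨ +-congʳ (+-cong ω-wv (*-congˡ (ω-basisˡ p v))) ⟩
          (τ p + - w p * (τ p * v p′)) + - w p′ * (- τ p * v p)
            ∎))
        entry : T p t (- θ * w p′) v p′ ≈ v p′ + θ * (1# - v p′ * w p)
        entry = begin
          (v p′ + v p * t p′) + (- θ * w p′ * v p - τ p * ω t v) * δ p′ p′
            ≈⟨ +-cong (+-congˡ (*-congˡ (OffPair.at-p′ (*ᵥ-offPair (- θ) (off-offPair p w)))))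
                      (*-cong (+-congˡ (-‿cong (*-congˡ form))) (δ-≡ {i = p′} ≡.refl)) ⟩
          (v p′ + v p * 0#) + (- θ * w p′ * v p - τ p *
              (- θ * ((τ p + - w p * (τ p * v p′)) + - w p′ * (- τ p * v p)))) * 1#
            ≈⟨ solve 6 (λ x x′ y y′ θ τ →
                 (x′ :+ x :* con (+ 0)) :+ (:- θ :* y′ :* x :- τ :*
                     (:- θ :* ((τ :+ :- y :* (τ :* x′)) :+ :- y′ :* (:- τ :* x)))) :* con (+ 1)
                 := (x′ :+ (τ :* τ) :* (θ :* (con (+ 1) :- x′ :* y))) :+ (τ :* τ :- con (+ 1)) :* (θ :* y′ :* x))
               refl (v p) (v p′) (w p) (w p′) θ (τ p) ⟩
          (v p′ + (τ p * τ p) * (θ * (1# - v p′ * w p))) + (τ p * τ p - 1#) * (θ * w p′ * v p)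
            ≈⟨ +-cong (+-congˡ (*-congʳ (τ*τ p))) (*-congʳ (+-congʳ (τ*τ p))) ⟩
          (v p′ + 1# * (θ * (1# - v p′ * w p))) + (1# - 1#) * (θ * w p′ * v p)
            ≈⟨ solve 3 (λ x y z → (x :+ con (+ 1) :* y) :+ (con (+ 1) :- con (+ 1)) :* z := x :+ y)
               refl (v p′) (θ * (1# - v p′ * w p)) (θ * w p′ * v p) ⟩
          v p′ + θ * (1# - v p′ * w p)
            ∎

      -- `T p 0ᵥ c` changes an entry only by a multiple of the entry in the partner row. So the unit
      -- in row `p +m` first produces a 1 in row `p`, which in turn produces a 1 in row `p +m`.
      one-pivot : ∀ {A} p → IsSymplectic A → ∃[ B ] Step p (cost ℕ.+ (cost ℕ.+ cost)) A B × B (p +m) (p +m) ≈ 1#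
      one-pivot {A} p symp =
        let A₁ , s₁ , u , unit = unit-pivot p symp
            A₂ , s₂ , one = normalize-partner {A₁} (p +m) (p +m) u (symplectic s₁) unit
            A₃ , s₃ , one′ = normalize-partner {A₂} p (p +m) 1# (symplectic s₂)
                (trans (*-identityʳ _) (trans (reflexive (≡.cong (λ i → A₂ i (p +m)) (≡.sym (+m-involutive p))))
                    one))
        in A₃ , step-trans {p} {B = A₁} s₁ (step-trans {p} {B = A₂} (step-+m {p} s₂) s₃) , one′

      pairCost : ℕ
      pairCost = (cost ℕ.+ (cost ℕ.+ cost)) ℕ.+ (cost ℕ.+ cost)

      -- Once column `p +m` is reduced, row `p` is trivial, so the pivot for column `p` is already
      -- 1. This brings the total to 3 + 1 + 1 unipotents.
      fix-pair : ∀ {A} p → IsSymplectic A → ∃[ B ] Step p pairCost A B × FixedPair B p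
      fix-pair {A} p symp =
        let A₁ , s₁ , one = one-pivot p symp
            A₂ , s₂ , fixed′ , _ = clear-column {A₁} (p +m) (symplectic s₁) one
            one′ : A₂ p p ≈ 1#
            one′ = trans (reflexive (≡.cong (λ i → A₂ i p) (≡.sym (+m-involutive p))))
              (trans (fixedColumn⇒row {A₂} (symplectic s₂) (p +m) fixed′ p) (δ-≡ (+m-involutive p)))
            A₃ , s₃ , fixed , keep = clear-column {A₂} p (symplectic s₂) one′
        in A₃ , step-trans {p} {B = A₁} s₁ (step-trans {p} {B = A₂} (step-+m {p} s₂) s₃) , fixed , keep fixed′

      -- For `f = id` each pair is processed once for each of its two indices. This doubles the
      -- count and spares an enumeration of the pairs.
      fix-pairs : ∀ {n} (f : Fin n → Index) {A} → IsSymplectic A →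
        ∃[ B ] IsSymplectic B × A ⟶[ n ℕ.* pairCost ] B × (∀ i → FixedPair B (f i))
      fix-pairs {zero}  f {A} symp = A , symp , ⟶-refl , λ ()
      fix-pairs {suc n} f {A} symp =
        let A₁ , symp₁ , reach₁ , fixed₁ = fix-pairs (f ∘ suc) symp
            A₂ , s₂ , fixed₂ = fix-pair {A₁} (f zero) symp₁
        in A₂ , symplectic s₂
         , ⟶-≤ (ℕ.≤-reflexive (ℕ.+-comm (n ℕ.* pairCost) pairCost)) (⟶-trans reach₁ (reach s₂))
         , extend A₁ A₂ (preserves s₂) fixed₁ fixed₂
        where
        extend : ∀ A₁ A₂ → (∀ {b} → b ≢ f zero → b ≢ f zero +m → FixedPair A₁ b → FixedPair A₂ b) →
          (∀ i → FixedPair A₁ (f (suc i))) → FixedPair A₂ (f zero) → ∀ i → FixedPair A₂ (f i)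
        extend A₁ A₂ keep fixed₁ fixed₂ zero    = fixed₂
        extend A₁ A₂ keep fixed₁ fixed₂ (suc i) = pair-elim (f zero) (λ k → FixedPair A₁ k → FixedPair A₂ k)
          (λ _ → fixed₂) (λ _ → fixedPair-+m {A₂} (f zero) fixed₂) (λ k k≢ k≢′ → keep {k} k≢ k≢′) (f (suc i))
              (fixed₁ i)

      symplectic-factorization : (S : Sp) →
        ∃[ ops ] (All ActsOnSp ops × length ops ≤ (m ℕ.+ m) ℕ.* pairCost × Unit.value (product ops) ≋ Sp.matrix S)
      symplectic-factorization S =
        let B , _ , r , fixed = fix-pairs id (Sp.isSymplectic S)
        in ops r , actsOnSp r , length≤ r , trivial r λ k l → proj₁ (fixed l) k
        where
        trivial : ∀ {B N} (r : Sp.matrix S ⟶[ N ] B) → B ≋ 𝟙 → Unit.value (product (ops r)) ≋ Sp.matrix S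
        trivial {B} r B≋𝟙 i j = begin
          P i j            ≈⟨ ·-identityʳ P i j ⟨
          (P · 𝟙) i j      ≈⟨ ·-cong {P} {P} {B} {𝟙} (λ _ _ → refl) B≋𝟙 i j ⟨
          (P · B) i j      ≈⟨ factors r i j ⟩
          Sp.matrix S i j  ∎
          where P = Unit.value (product (ops r))

-- 81 = 27 · 3 operations make an elementary unipotent. Since `1 ≤ m` gives `1 + 2m ≤ 3m`, the total
-- is at most `2m · 5 · 3m · 81`, which is `2430 m²`.
operationCount : ∀ m → 1 ≤ m → let k = (1 ℕ.+ (m ℕ.+ m)) ℕ.* 81 in
  (m ℕ.+ m) ℕ.* ((k ℕ.+ (k ℕ.+ k)) ℕ.+ (k ℕ.+ k)) ≤ 2430 ℕ.* m ℕ.^ 2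
operationCount m 1≤m = ℕ.≤-trans (ℕ.*-monoʳ-≤ (m ℕ.+ m) (five bound)) (ℕ.≤-reflexive (total m))
  where
  bound : (1 ℕ.+ (m ℕ.+ m)) ℕ.* 81 ≤ (m ℕ.+ (m ℕ.+ m)) ℕ.* 81
  bound = ℕ.*-monoˡ-≤ 81 (ℕ.+-monoˡ-≤ (m ℕ.+ m) 1≤m)
  five : ∀ {k l} → k ≤ l → (k ℕ.+ (k ℕ.+ k)) ℕ.+ (k ℕ.+ k) ≤ (l ℕ.+ (l ℕ.+ l)) ℕ.+ (l ℕ.+ l)
  five k≤l = ℕ.+-mono-≤ (ℕ.+-mono-≤ k≤l (ℕ.+-mono-≤ k≤l k≤l)) (ℕ.+-mono-≤ k≤l k≤l)
  -- The right-hand side is `m ^ 2` unfolded, in a form that the solver accepts.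
  total : ∀ m → let l = (m ℕ.+ (m ℕ.+ m)) ℕ.* 81 in
    (m ℕ.+ m) ℕ.* ((l ℕ.+ (l ℕ.+ l)) ℕ.+ (l ℕ.+ l)) ≡ 2430 ℕ.* (m ℕ.* (m ℕ.* 1))
  total = ℕ-Solver.solve-∀

open import Data.Nat.Base using (ℕ; _≤_; _<_; _*_; _^_)

mainTheorem5 : ∃[ c ] (0 < c × (∀ (m n : ℕ) → 1 ≤ m → 1 ≤ n →
    let open Symplectic (ℤ/ n) m in
    (S : Sp) →
    ∃[ ops ] (All ActsOnSp ops ×
    length ops ≤ c * m ^ 2 ×
    Unit.value (product ops) ≋ Sp.matrix S)))
mainTheorem5 = 2430 , ℕ.z<s , λ m n 1≤m 1≤n S →
  -- This excludes `ℤ/ 0`, which is ℤ and does not have stable range 1.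
  let instance _ = ℕ.>-nonZero 1≤n
      ops , acts , length≤ , eq = Reduction.symplectic-factorization (ℤ/ n) m
        (ℤ/-unitSquareSum n) (ℤ/-stableRange1 n) S
  in ops , acts , ℕ.≤-trans length≤ (operationCount m 1≤m) , eq
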